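{- Let $H$ be any hypergraph and let $s\ge 2$ be an integer. Then $\pi(H(s))=\pi(H)$.
   Context: A hypergraph $G=(V,E)$ has a finite vertex set and edge set $E\subseteq 2^V$ (edges may have different sizes); $R(G)=\{|F|\colon F\in E\}$. For $G$ on $n$ vertices, $h_n(G)=\sum_{F\in E(G)}1/\binom{n}{|F|}$. $H$ is a subgraph of $G$ if there is an injective $f\colon V(H)\to V(G)$ with $f(F)\in E(G)$ for all $F\in E(H)$. $\pi_n(H)=\max\{h_n(G)\colon v(G)=n,\ R(G)\subseteq R(H),\ H\text{ not a subgraph of }G\}$ and $\pi(H)=\lim_{n\to\infty}\pi_n(H)$. For a hypergraph $H$ on vertex set $[m]$ and positive integers $s_1,\dots,s_m$, the blowup $H(s_1,\dots,s_m)$ has vertex set $V_1\sqcup\cdots\sqcup V_m$ with $|V_i|=s_i$ and edge set $\bigcup_{F\in E(H)}\prod_{i\in F}V_i$, i.e. all sets containing exactly one vertex from each $V_i$, $i\in F$, for some $F\in E(H)$; $H(s)=H(s,\dots,s)$. -}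

module Defs where

open import Data.Nat as ℕ using (ℕ; zero; suc)
open import Data.Nat.Combinatorics using (_C_)
open import Data.Fin using (Fin; combine)
open import Data.Fin.Subset using (Subset; _∈_; ∣_∣)
open import Data.Fin.Subset.Properties using (_∈?_)
open import Data.Fin.Properties using (any?; _≟_)
open import Data.Vec using (tabulate)
open import Data.List using (List; foldr; map)
open import Data.List.Relation.Unary.Unique.Propositional using (Unique)
import Data.List.Membership.Propositional as LM
open import Data.Integer using (+_)
open import Data.Rational using (ℚ; 0ℚ; _/_; _+_; _≤_)
open import Data.Product using (Σ; ∃; _×_; _,_)
open import Relation.Nullary using (¬_; does)
open import Relation.Nullary.Decidable using (_×-dec_)
open import Relation.Binary.PropositionalEquality using (_≡_)
open import Function.Definitions using (Injective)

record Hypergraph : Set₁ where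
  field
    v : ℕ
    E : Subset v → Set
open Hypergraph public

image : {m n : ℕ} → (Fin m → Fin n) → Subset m → Subset n
image f F = tabulate (λ j → does (any? (λ i → (i ∈? F) ×-dec (f i ≟ j))))

RSub : Hypergraph → Hypergraph → Set
RSub G H = ∀ F → E G F → Σ (Subset (v H)) (λ F' → E H F' × ∣ F' ∣ ≡ ∣ F ∣)

SubgraphOf : Hypergraph → Hypergraph → Set
SubgraphOf H G = Σ (Fin (v H) → Fin (v G)) (λ f →
  Injective _≡_ _≡_ f × (∀ F → E H F → E G (image f F)))

-- The blowup H(s): V_i = { combine i j | j : Fin s }, vertex set Fin (v * s).
-- Edges: for each edge F of H, pick one vertex c i ∈ V_i for every i ∈ F.
blowup : Hypergraph → ℕ → Hypergraph
blowup H s = record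
  { v = v H ℕ.* s
  ; E = λ X → Σ (Subset (v H)) (λ F → E H F ×
          Σ (Fin (v H) → Fin s) (λ c → X ≡ image (λ i → combine i (c i)) F)) }

asHG : (n : ℕ) → List (Subset n) → Hypergraph
asHG n G = record { v = n ; E = λ F → F LM.∈ G }

-- 1/k as a rational (with the harmless convention 1/0 = 0; never used at 0
-- since binom(n,|F|) > 0 for F ⊆ [n])
inv : ℕ → ℚ
inv zero = 0ℚ
inv (suc k) = + 1 / suc k

h : (n : ℕ) → List (Subset n) → ℚ
h n G = foldr _+_ 0ℚ (map (λ F → inv (n C ∣ F ∣)) G)

Admissible : Hypergraph → (n : ℕ) → List (Subset n) → Set
Admissible H n G = Unique G × RSub (asHG n G) H × ¬ SubgraphOf H (asHG n G)

IsPiN : Hypergraph → ℕ → ℚ → Set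
IsPiN H n q =
  Σ (List (Subset n)) (λ G → Admissible H n G × h n G ≡ q)
  × (∀ G → Admissible H n G → h n G ≤ q)

{-# OPTIONS --safe #-}
module Submission where

-- Since H ⊆ H(s), π_n(H) ≤ π_n(H(s)). For the converse let G be an H(s)-free graph on [n]
-- attaining π_n(H(s)), fix a balanced map p : [n] → [k] with k constant, and for
-- x ∈ [n]^k let G_x be the pullback of G along φ = x ∘ p: its edges are the sets on which φ
-- is injective and whose image is an edge of G. On average over x the density of G_x is at
-- least that of G minus O(1/k), because a random section of φ over an edge of G almost
-- always meets different parts of p. A copy of H in G_x gives f : V(H) → [k] with x ∘ f a
-- homomorphism H → G injective on edges. If for some f a positive proportion of the x had
-- this property, then by the box theorem of Erdős (k successive applications of the power
-- mean inequality) they would contain a product of k disjoint large sets, hence a copy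
-- of H(s) in G. So G_x is H-free for almost all x, and π_n(H) is at least the average
-- density up to a small error.
--
-- The threshold for n depends only on v(H), s and ε: no rate of convergence of π_n(H) is
-- needed, and since the final inequality is decidable, E(H) may be assumed decidable.

open import Defs
open import Data.Nat using (ℕ; zero; suc; _+_; _*_; _^_; _∸_; z≤n; s≤s; _!; _/_; NonZero; >-nonZero) renaming (_≤_ to _≤ℕ_; _<_ to _<ℕ_)
import Data.Nat.Properties as ℕ
open import Data.Nat.Combinatorics using (_C_; nCk+nC[k+1]≡[n+1]C[k+1]; nCk≡n!/k![n-k]!; k![n∸k]!∣n!; k>n⇒nCk≡0; nCk≡nC[n∸k]; nCn≡1)
open import Data.Nat.DivMod using (m/n*n≡m; m≡m%n+[m/n]*n; m%n<n)
open import Data.Nat.Tactic.RingSolver using (solve-∀)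
import Data.Integer as ℤ
import Data.Integer.Properties as ℤ
open import Data.Rational using (ℚ; 0ℚ; _-_; _<_; _≤_; ∣_∣; mkℚ; toℚᵘ; fromℚᵘ; Positive)
import Data.Rational as ℚ
import Data.Rational.Properties as ℚ
open import Data.Rational.Solver using (module +-*-Solver)
open import Data.Rational.Unnormalised using (ℚᵘ; mkℚᵘ; *≡*; *≤*)
import Data.Rational.Unnormalised as ℚᵘ
import Data.Rational.Unnormalised.Properties as ℚᵘ
open import Data.Bool using (true; false)
import Data.Bool.Properties as Bool
open import Data.Fin using (Fin; zero; suc; combine; remQuot; quotient; inject≤)
import Data.Fin.Properties as Fin
open import Data.Fin.Subset using (Subset; _∈_; inside; outside; ⊤) renaming (∣_∣ to ∣_∣ˢ)
open import Data.Fin.Subset.Properties using (_∈?_; ⊆-antisym; drop-there; ∈⊤; ∣p∣≤n; anySubset?)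
open import Data.List as List using (List; []; _∷_; length; cartesianProductWith; cartesianProduct; allFin; filter; upTo)
import Data.List.Properties as List
open import Data.List.Membership.Propositional using () renaming (_∈_ to _∈ˡ_)
open import Data.List.Membership.DecPropositional using () renaming (_∈?_ to member?)
import Data.List.Membership.Propositional.Properties as Membership
open import Data.List.Relation.Unary.Any using (here; there)
open import Data.List.Relation.Unary.All as All using ([]; _∷_)
open import Data.List.Relation.Unary.AllPairs using ([]; _∷_)
open import Data.List.Relation.Unary.Unique.Propositional using () renaming (Unique to Uniqueˡ)
import Data.List.Relation.Unary.Unique.Propositional.Properties as Uniqueˡ
open import Data.Vec as Vec using (Vec; []; _∷_; lookup; _[_]≔_; here; there)
import Data.Vec.Properties as Vec
open import Data.Vec.Relation.Unary.All using ([]; _∷_) renaming (All to Allᵛ)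
open import Data.Vec.Relation.Unary.AllPairs as AllPairsᵛ using ([]; _∷_)
open import Data.Vec.Relation.Unary.Unique.Propositional using () renaming (Unique to Uniqueᵛ)
import Data.Vec.Relation.Unary.Unique.Propositional.Properties as Uniqueᵛ
open import Data.Product using (Σ; ∃; _×_; _,_; proj₁; proj₂)
open import Data.Sum using (inj₁; inj₂)
open import Data.Unit using (tt)
open import Algebra.Properties.AbelianGroup ℚ.+-0-abelianGroup using (xyx⁻¹≈y)
open import Algebra.Properties.CommutativeSemigroup ℕ.+-commutativeSemigroup using (interchange)
open import Function using (_∘_; id)
open import Function.Definitions using (Injective)
open import Level using (Level)
open import Relation.Binary.Definitions using (DecidableEquality)
open import Relation.Binary.PropositionalEquality
open import Relation.Nullary using (¬_; Dec; yes; no; contradiction; does)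
open import Relation.Nullary.Decidable using (_×-dec_; _→-dec_; ¬?; dec-true; decidable-stable; ¬¬-excluded-middle)
open import Relation.Nullary.Negation using (¬¬-map)
open import Relation.Unary using (Decidable)

private variable
  ℓ ℓ' : Level
  A B I : Set
  P : Set ℓ
  Q : Set ℓ'

-- Finite sums and indicators

∑ : List A → (A → ℕ) → ℕ
∑ []       f = 0
∑ (x ∷ xs) f = f x + ∑ xs f

infix 5 ∑
syntax ∑ xs (λ x → e) = ∑[ x ← xs ] e

∑-mono-∈ : ∀ (xs : List A) {f g} → (∀ {x} → x ∈ˡ xs → f x ≤ℕ g x) → ∑ xs f ≤ℕ ∑ xs g
∑-mono-∈ []       h = z≤n
∑-mono-∈ (x ∷ xs) h = ℕ.+-mono-≤ (h (here refl)) (∑-mono-∈ xs (h ∘ there))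

∑-mono : ∀ (xs : List A) {f g} → (∀ x → f x ≤ℕ g x) → ∑ xs f ≤ℕ ∑ xs g
∑-mono xs h = ∑-mono-∈ xs (λ {x} _ → h x)

∑-cong : ∀ (xs : List A) {f g} → (∀ x → f x ≡ g x) → ∑ xs f ≡ ∑ xs g
∑-cong []       h = refl
∑-cong (x ∷ xs) h = cong₂ _+_ (h x) (∑-cong xs h)

∑-+ : ∀ (xs : List A) f g → (∑[ x ← xs ] (f x + g x)) ≡ ∑ xs f + ∑ xs g
∑-+ []       f g = refl
∑-+ (x ∷ xs) f g = trans (cong (f x + g x +_) (∑-+ xs f g)) (interchange (f x) (g x) (∑ xs f) (∑ xs g))

∑-*ˡ : ∀ (xs : List A) c f → (∑[ x ← xs ] (c * f x)) ≡ c * ∑ xs f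
∑-*ˡ []       c f = sym (ℕ.*-zeroʳ c)
∑-*ˡ (x ∷ xs) c f = trans (cong (c * f x +_) (∑-*ˡ xs c f)) (sym (ℕ.*-distribˡ-+ c (f x) (∑ xs f)))

∑-*ʳ : ∀ (xs : List A) c f → (∑[ x ← xs ] (f x * c)) ≡ ∑ xs f * c
∑-*ʳ []       c f = refl
∑-*ʳ (x ∷ xs) c f = trans (cong (f x * c +_) (∑-*ʳ xs c f)) (sym (ℕ.*-distribʳ-+ c (f x) (∑ xs f)))

∑-const : ∀ (xs : List A) c → (∑[ _ ← xs ] c) ≡ length xs * c
∑-const []       c = refl
∑-const (x ∷ xs) c = cong (c +_) (∑-const xs c)

∑-≤-const : ∀ (xs : List A) {f c} → (∀ x → f x ≤ℕ c) → ∑ xs f ≤ℕ length xs * c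
∑-≤-const xs h = ℕ.≤-trans (∑-mono xs h) (ℕ.≤-reflexive (∑-const xs _))

∑-swap : ∀ (xs : List A) (ys : List B) (f : A → B → ℕ) →
         (∑[ x ← xs ] ∑[ y ← ys ] f x y) ≡ (∑[ y ← ys ] ∑[ x ← xs ] f x y)
∑-swap []       ys f = sym (trans (∑-const ys 0) (ℕ.*-zeroʳ (length ys)))
∑-swap (x ∷ xs) ys f = trans (cong (∑ ys (f x) +_) (∑-swap xs ys f)) (sym (∑-+ ys (f x) _))

∑-++ : ∀ (xs ys : List A) f → ∑ (xs List.++ ys) f ≡ ∑ xs f + ∑ ys f
∑-++ []       ys f = refl
∑-++ (x ∷ xs) ys f = trans (cong (f x +_) (∑-++ xs ys f)) (sym (ℕ.+-assoc (f x) (∑ xs f) (∑ ys f)))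

∑-map : ∀ (h : A → B) xs f → ∑ (List.map h xs) f ≡ ∑ xs (f ∘ h)
∑-map h []       f = refl
∑-map h (x ∷ xs) f = cong (f (h x) +_) (∑-map h xs f)

∑-cartesianProductWith : ∀ (_⊗_ : A → B → I) xs ys f →
  ∑ (cartesianProductWith _⊗_ xs ys) f ≡ (∑[ x ← xs ] ∑[ y ← ys ] f (x ⊗ y))
∑-cartesianProductWith _⊗_ []       ys f = refl
∑-cartesianProductWith _⊗_ (x ∷ xs) ys f = trans
  (∑-++ (List.map (x ⊗_) ys) _ f)
  (cong₂ _+_ (∑-map (x ⊗_) ys f) (∑-cartesianProductWith _⊗_ xs ys f))

length-cartesianProductWith : ∀ (_⊗_ : A → B → I) xs ys → length (cartesianProductWith _⊗_ xs ys) ≡ length xs * length ys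
length-cartesianProductWith _⊗_ []       ys = refl
length-cartesianProductWith _⊗_ (x ∷ xs) ys = trans
  (List.length-++ (List.map (x ⊗_) ys))
  (cong₂ _+_ (List.length-map (x ⊗_) ys) (length-cartesianProductWith _⊗_ xs ys))

term≤∑ : ∀ {xs : List A} {x} f → x ∈ˡ xs → f x ≤ℕ ∑ xs f
term≤∑ f (here refl) = ℕ.m≤m+n _ _
term≤∑ f (there i)   = ℕ.≤-trans (term≤∑ f i) (ℕ.m≤n+m _ _)

𝟙 : Dec P → ℕ
𝟙 (yes _) = 1
𝟙 (no _)  = 0

𝟙-true : (d : Dec P) → P → 𝟙 d ≡ 1
𝟙-true (yes _) p = refl
𝟙-true (no ¬p) p = contradiction p ¬p

𝟙-false : (d : Dec P) → ¬ P → 𝟙 d ≡ 0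
𝟙-false (yes p) ¬p = contradiction p ¬p
𝟙-false (no _)  ¬p = refl

𝟙≤1 : (d : Dec P) → 𝟙 d ≤ℕ 1
𝟙≤1 (yes _) = ℕ.≤-refl
𝟙≤1 (no _)  = z≤n

𝟙-mono : (d : Dec P) (e : Dec Q) → (P → Q) → 𝟙 d ≤ℕ 𝟙 e
𝟙-mono (yes p) e h = ℕ.≤-reflexive (sym (𝟙-true e (h p)))
𝟙-mono (no _)  e h = z≤n

module _ {R : A → Set} (R? : ∀ x → Dec (R x)) where

  ∑𝟙-none : ∀ xs → (∀ {x} → x ∈ˡ xs → ¬ R x) → (∑[ x ← xs ] 𝟙 (R? x)) ≡ 0
  ∑𝟙-none []       h = refl
  ∑𝟙-none (x ∷ xs) h rewrite 𝟙-false (R? x) (h (here refl)) = ∑𝟙-none xs (h ∘ there)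

  ∑𝟙-atMostOne : ∀ {xs} → Uniqueˡ xs → (∀ {x y} → R x → R y → x ≡ y) →
                 (d : Dec Q) → (∀ {x} → R x → Q) → (∑[ x ← xs ] 𝟙 (R? x)) ≤ℕ 𝟙 d
  ∑𝟙-atMostOne []           inj d toQ = z≤n
  ∑𝟙-atMostOne {xs = x ∷ xs} (x∉ ∷ u) inj d toQ with R? x
  ... | no  _ = ∑𝟙-atMostOne u inj d toQ
  ... | yes r rewrite ∑𝟙-none xs (λ y∈ r' → All.lookup x∉ y∈ (inj r r')) =
    ℕ.≤-reflexive (sym (𝟙-true d (toQ r)))

  ∑𝟙-exactlyOne : ∀ {xs} → Uniqueˡ xs → (∀ {x y} → R x → R y → x ≡ y) →
                  (d : Dec Q) → (∀ {x} → R x → Q) → (Q → ∃ λ x → x ∈ˡ xs × R x) →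
                  (∑[ x ← xs ] 𝟙 (R? x)) ≡ 𝟙 d
  ∑𝟙-exactlyOne {xs = xs} u inj d toQ fromQ = ℕ.≤-antisym (∑𝟙-atMostOne u inj d toQ) (lower d)
    where
    lower : (d : Dec _) → 𝟙 d ≤ℕ (∑[ x ← xs ] 𝟙 (R? x))
    lower (no _)  = z≤n
    lower (yes q) with x , x∈ , r ← fromQ q =
      ℕ.≤-trans (ℕ.≤-reflexive (sym (𝟙-true (R? x) r))) (term≤∑ (𝟙 ∘ R?) x∈)

∑𝟙-≡ : (_≟_ : DecidableEquality A) → ∀ {xs} → Uniqueˡ xs → ∀ {x} → x ∈ˡ xs → (∑[ y ← xs ] 𝟙 (x ≟ y)) ≡ 1
∑𝟙-≡ _≟_ u {x} x∈ =
  ∑𝟙-exactlyOne (x ≟_) u (λ p q → trans (sym p) q) (yes tt) (λ _ → tt) (λ _ → x , x∈ , refl)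

-- Double counting of the graph of `h` over `R`: every `x` in `R` lies in exactly one pair, and
-- every `y` in at most one, which requires `S y`.
∑𝟙-inject : {R : A → Set} (R? : ∀ x → Dec (R x)) {S : B → Set} (S? : ∀ y → Dec (S y)) →
            (_≟_ : DecidableEquality B) →
            ∀ {xs} → Uniqueˡ xs → ∀ {ys} → Uniqueˡ ys → (∀ y → y ∈ˡ ys) →
            (h : A → B) → (∀ {x} → R x → S (h x)) → (∀ {x x'} → R x → R x' → h x ≡ h x' → x ≡ x') →
            (∑[ x ← xs ] 𝟙 (R? x)) ≤ℕ (∑[ y ← ys ] 𝟙 (S? y))
∑𝟙-inject R? S? _≟_ {xs} uxs {ys} uys complete h RS inj = begin
  (∑[ x ← xs ] 𝟙 (R? x))                                  ≡⟨ ∑-cong xs (λ x → sym (∑𝟙-exactlyOne (R×? x) uys (λ p q → trans (sym (proj₂ p)) (proj₂ q)) (R? x) proj₁ (λ r → h x , complete _ , r , refl))) ⟩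
  (∑[ x ← xs ] ∑[ y ← ys ] 𝟙 (R×? x y))                   ≡⟨ ∑-swap xs ys _ ⟩
  (∑[ y ← ys ] ∑[ x ← xs ] 𝟙 (R×? x y))                   ≤⟨ ∑-mono ys (λ y → ∑𝟙-atMostOne (λ x → R×? x y) uxs (λ p q → inj (proj₁ p) (proj₁ q) (trans (proj₂ p) (sym (proj₂ q)))) (S? y) (λ { (r , refl) → RS r })) ⟩
  (∑[ y ← ys ] 𝟙 (S? y))                                  ∎
  where
  open ℕ.≤-Reasoning
  R×? : ∀ x y → Dec (_ × h x ≡ y)
  R×? x y = R? x ×-dec (h x ≟ y)

-- Vectors with entries in a list

vecs : List A → (k : ℕ) → List (Vec A k)
vecs xs zero    = [] ∷ []
vecs xs (suc k) = cartesianProductWith _∷_ xs (vecs xs k)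

∑-vecs-suc : ∀ (xs : List A) k f → ∑ (vecs xs (suc k)) f ≡ (∑[ x ← xs ] ∑[ z ← vecs xs k ] f (x ∷ z))
∑-vecs-suc xs k f = ∑-cartesianProductWith _∷_ xs (vecs xs k) f

length-vecs : ∀ (xs : List A) k → length (vecs xs k) ≡ length xs ^ k
length-vecs xs zero    = refl
length-vecs xs (suc k) = trans (length-cartesianProductWith _∷_ xs (vecs xs k)) (cong (length xs *_) (length-vecs xs k))

vecs-unique : ∀ {xs : List A} → Uniqueˡ xs → ∀ k → Uniqueˡ (vecs xs k)
vecs-unique u zero    = [] ∷ []
vecs-unique u (suc k) = Uniqueˡ.cartesianProductWith⁺ _∷_ Vec.∷-injective u (vecs-unique u k)

∈-vecs : ∀ {xs : List A} → (∀ x → x ∈ˡ xs) → ∀ {k} (z : Vec A k) → z ∈ˡ vecs xs k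
∈-vecs h []      = here refl
∈-vecs h (x ∷ z) = Membership.∈-cartesianProductWith⁺ _∷_ (h x) (∈-vecs h z)

∑-vecs-+ : ∀ (xs : List A) m n f →
           ∑ (vecs xs (m + n)) f ≡ (∑[ y ← vecs xs m ] ∑[ z ← vecs xs n ] f (y Vec.++ z))
∑-vecs-+ xs zero    n f = sym (ℕ.+-identityʳ _)
∑-vecs-+ xs (suc m) n f = begin
  ∑ (vecs xs (suc m + n)) f
    ≡⟨ ∑-vecs-suc xs (m + n) f ⟩
  (∑[ x ← xs ] ∑[ w ← vecs xs (m + n) ] f (x ∷ w))
    ≡⟨ ∑-cong xs (λ x → ∑-vecs-+ xs m n _) ⟩
  (∑[ x ← xs ] ∑[ y ← vecs xs m ] ∑[ z ← vecs xs n ] f (x ∷ y Vec.++ z))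
    ≡⟨ ∑-vecs-suc xs m _ ⟨
  (∑[ y ← vecs xs (suc m) ] ∑[ z ← vecs xs n ] f (y Vec.++ z)) ∎
  where open ≡-Reasoning

-- Lets the `k` tuples spanning a box be read as one long tuple, so that counts of tuples with
-- distinct entries apply to boxes.
∑-vecs-concat : ∀ (xs : List A) k n f →
                (∑[ ys ← vecs (vecs xs n) k ] f (Vec.concat ys)) ≡ ∑ (vecs xs (k * n)) f
∑-vecs-concat xs zero    n f = refl
∑-vecs-concat xs (suc k) n f = begin
  (∑[ ys ← vecs (vecs xs n) (suc k) ] f (Vec.concat ys))
    ≡⟨ ∑-vecs-suc (vecs xs n) k _ ⟩
  (∑[ y ← vecs xs n ] ∑[ ys ← vecs (vecs xs n) k ] f (y Vec.++ Vec.concat ys))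
    ≡⟨ ∑-cong (vecs xs n) (λ y → ∑-vecs-concat xs k n _) ⟩
  (∑[ y ← vecs xs n ] ∑[ z ← vecs xs (k * n) ] f (y Vec.++ z))
    ≡⟨ ∑-vecs-+ xs n (k * n) f ⟨
  ∑ (vecs xs (n + k * n)) f ∎
  where open ≡-Reasoning

points : (n k : ℕ) → List (Vec (Fin n) k)
points n = vecs (allFin n)

points-unique : ∀ n k → Uniqueˡ (points n k)
points-unique n = vecs-unique (Uniqueˡ.allFin⁺ n)

∈-points : ∀ {n k} (x : Vec (Fin n) k) → x ∈ˡ points n k
∈-points = ∈-vecs Membership.∈-allFin

length-allFin : ∀ n → length (allFin n) ≡ n
length-allFin n = List.length-tabulate id

length-points : ∀ n k → length (points n k) ≡ n ^ k
length-points n k = trans (length-vecs (allFin n) k) (cong (_^ k) (length-allFin n))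

-- Boxes in dense sets of tuples

-- The two sides differ by a square. Writing the larger number as the smaller plus `d` exhibits it
-- as `d * d` without subtraction.
2xc≤x²+c² : ∀ x c → 2 * (x * c) ≤ℕ x * x + c * c
2xc≤x²+c² x c with ℕ.≤-total x c
... | inj₁ x≤c with d , refl ← ℕ.m≤n⇒∃[o]m+o≡n x≤c = ℕ.m+n≤o⇒m≤o _ (ℕ.≤-reflexive (eq x d))
  where
  eq : ∀ x d → 2 * (x * (x + d)) + d * d ≡ x * x + (x + d) * (x + d)
  eq = solve-∀
... | inj₂ c≤x with d , refl ← ℕ.m≤n⇒∃[o]m+o≡n c≤x = ℕ.m+n≤o⇒m≤o _ (ℕ.≤-reflexive (eq c d))
  where
  eq : ∀ c d → 2 * ((c + d) * c) + d * d ≡ (c + d) * (c + d) + c * c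
  eq = solve-∀

-- The tangent line of x ↦ x ^ (t + 1) at c, with the negative term moved to the right.
tangent-≤ : ∀ t c x → suc t * (c ^ t * x) ≤ℕ x ^ suc t + t * c ^ suc t
tangent-≤ zero    c x = ℕ.≤-reflexive (eq x)
  where
  eq : ∀ x → 1 * (1 * x) ≡ x * 1 + 0
  eq = solve-∀
-- Adding `t * (c * u * x)` to both sides turns the left one into a multiple of `2 * (x * c)`;
-- bounding this by squares leaves a factor to which the induction hypothesis applies.
tangent-≤ (suc t) c x = ℕ.+-cancelˡ-≤ (t * (c * u * x)) _ _ (begin
  t * (c * u * x) + suc (suc t) * (c * u * x)            ≡⟨ eq₁ t c x u ⟩
  suc t * u * (2 * (x * c))                              ≤⟨ ℕ.*-monoʳ-≤ (suc t * u) (2xc≤x²+c² x c) ⟩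
  suc t * u * (x * x + c * c)                            ≡⟨ eq₂ t c x u ⟩
  suc t * (u * x) * x + suc t * (c * (c * u))            ≤⟨ ℕ.+-monoˡ-≤ _ (ℕ.*-monoˡ-≤ x (tangent-≤ t c x)) ⟩
  (x * w + t * (c * u)) * x + suc t * (c * (c * u))      ≡⟨ eq₃ t c x u w ⟩
  t * (c * u * x) + (x * (x * w) + suc t * (c * (c * u))) ∎)
  where
  open ℕ.≤-Reasoning
  u w : ℕ
  u = c ^ t
  w = x ^ t
  eq₁ : ∀ t c x u → t * (c * u * x) + suc (suc t) * (c * u * x) ≡ suc t * u * (2 * (x * c))
  eq₁ = solve-∀
  eq₂ : ∀ t c x u → suc t * u * (x * x + c * c) ≡ suc t * (u * x) * x + suc t * (c * (c * u))
  eq₂ = solve-∀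
  eq₃ : ∀ t c x u w → (x * w + t * (c * u)) * x + suc t * (c * (c * u)) ≡ t * (c * u * x) + (x * (x * w) + suc t * (c * (c * u)))
  eq₃ = solve-∀

^-distribʳ-* : ∀ t m n → (m * n) ^ t ≡ m ^ t * n ^ t
^-distribʳ-* zero    m n = refl
^-distribʳ-* (suc t) m n = trans (cong (m * n *_) (^-distribʳ-* t m n)) (ℕ.[m*n]*[o*p]≡[m*o]*[n*p] m n (m ^ t) (n ^ t))

-- Jensen's inequality: sum the tangent line at `c` over the values `D * f z`, whose mean is at
-- least `c`. The factor `D` keeps the densities integral.
power-mean : ∀ (Z : List A) f c D T → length Z * c ≤ℕ D * ∑ Z f →
             length Z * c ^ T ≤ℕ D ^ T * (∑[ z ← Z ] f z ^ T)
power-mean Z f c D zero    h = ℕ.≤-reflexive (sym (trans (ℕ.+-identityʳ _) (∑-const Z 1)))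
power-mean Z f c D (suc t) h = ℕ.+-cancelʳ-≤ (length Z * (t * c ^ suc t)) _ _ (begin
  length Z * c ^ suc t + length Z * (t * c ^ suc t)          ≡⟨ eq (length Z) t c (c ^ t) ⟩
  suc t * (c ^ t * (length Z * c))                           ≤⟨ ℕ.*-monoʳ-≤ (suc t) (ℕ.*-monoʳ-≤ (c ^ t) h) ⟩
  suc t * (c ^ t * (D * ∑ Z f))                              ≡⟨ cong (λ s → suc t * (c ^ t * s)) (∑-*ˡ Z D f) ⟨
  suc t * (c ^ t * (∑[ z ← Z ] D * f z))                     ≡⟨ cong (suc t *_) (∑-*ˡ Z (c ^ t) _) ⟨
  suc t * (∑[ z ← Z ] c ^ t * (D * f z))                     ≡⟨ ∑-*ˡ Z (suc t) _ ⟨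
  (∑[ z ← Z ] suc t * (c ^ t * (D * f z)))                   ≤⟨ ∑-mono Z (λ z → tangent-≤ t c (D * f z)) ⟩
  (∑[ z ← Z ] ((D * f z) ^ suc t + t * c ^ suc t))           ≡⟨ ∑-+ Z _ _ ⟩
  (∑[ z ← Z ] (D * f z) ^ suc t) + (∑[ _ ← Z ] t * c ^ suc t) ≡⟨ cong₂ _+_ (∑-cong Z (λ z → ^-distribʳ-* (suc t) D (f z))) (∑-const Z _) ⟩
  (∑[ z ← Z ] D ^ suc t * f z ^ suc t) + length Z * (t * c ^ suc t) ≡⟨ cong (_+ _) (∑-*ˡ Z (D ^ suc t) _) ⟩
  D ^ suc t * (∑[ z ← Z ] f z ^ suc t) + length Z * (t * c ^ suc t) ∎)
  where
  open ℕ.≤-Reasoning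
  eq : ∀ l t c u → l * (c * u) + l * (t * (c * u)) ≡ suc t * (u * (l * c))
  eq = solve-∀

∏ : ∀ {T} → (A → ℕ) → Vec A T → ℕ
∏ f []      = 1
∏ f (x ∷ t) = f x * ∏ f t

-- Expansion of a power of a sum. In the box theorem it turns the `T`-th moment of a degree into a
-- count of `T`-tuples of extensions.
∑-∏ : ∀ (xs : List A) T f → (∑[ t ← vecs xs T ] ∏ f t) ≡ ∑ xs f ^ T
∑-∏ xs zero    f = refl
∑-∏ xs (suc T) f = begin
  (∑[ t ← vecs xs (suc T) ] ∏ f t)              ≡⟨ ∑-vecs-suc xs T _ ⟩
  (∑[ x ← xs ] ∑[ t ← vecs xs T ] f x * ∏ f t)  ≡⟨ ∑-cong xs (λ x → trans (∑-*ˡ (vecs xs T) (f x) _) (cong (f x *_) (∑-∏ xs T f))) ⟩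
  (∑[ x ← xs ] f x * ∑ xs f ^ T)                ≡⟨ ∑-*ʳ xs _ f ⟩
  ∑ xs f ^ suc T                                ∎
  where open ≡-Reasoning

∏≢0 : ∀ {T} (f : A → ℕ) (t : Vec A T) → ∏ f t ≢ 0 → ∀ i → f (lookup t i) ≢ 0
∏≢0 f (x ∷ t) h zero    f≡0 = h (cong (_* ∏ f t) f≡0)
∏≢0 f (x ∷ t) h (suc i) f≡0 = ∏≢0 f t (λ ∏≡0 → h (trans (cong (f x *_) ∏≡0) (ℕ.*-zeroʳ (f x)))) i f≡0

∏≤1 : ∀ {T} {f : A → ℕ} → (∀ x → f x ≤ℕ 1) → (t : Vec A T) → ∏ f t ≤ℕ 1
∏≤1 h []      = ℕ.≤-refl
∏≤1 h (x ∷ t) = ℕ.*-mono-≤ (h x) (∏≤1 h t)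

-- The product of the values of W over all the points of t₁ × ⋯ × t_k.
box : ∀ {k T} → (Vec A k → ℕ) → Vec (Vec A T) k → ℕ
box W []       = W []
box W (t ∷ ts) = box (λ z → ∏ (λ x → W (x ∷ z)) t) ts

box≢0 : ∀ {k T} (W : Vec A k → ℕ) (ts : Vec (Vec A T) k) → box W ts ≢ 0 →
        ∀ c → W (Vec.zipWith lookup ts c) ≢ 0
box≢0 W []       h []      = h
box≢0 W (t ∷ ts) h (i ∷ c) = ∏≢0 _ t (box≢0 _ ts h c) i

box≤1 : ∀ {k T} {W : Vec A k → ℕ} → (∀ z → W z ≤ℕ 1) → (ts : Vec (Vec A T) k) → box W ts ≤ℕ 1
box≤1 h []       = h []
box≤1 h (t ∷ ts) = box≤1 (λ z → ∏≤1 (λ x → h (x ∷ z)) t) ts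

-- The parameter set Z absorbs, one coordinate at a time, the T-tuples already chosen,
-- so that only the total density of W enters, and not that of its slices.
box-count : ∀ (xs : List A) T k (Z : List I) (W : I → Vec A k → ℕ) D →
            length Z * length xs ^ k ≤ℕ D * (∑[ a ← Z ] ∑[ z ← vecs xs k ] W a z) →
            length Z * (length xs ^ T) ^ k ≤ℕ
              D ^ (T ^ k) * (∑[ a ← Z ] ∑[ ts ← vecs (vecs xs T) k ] box (W a) ts)
box-count xs T zero    Z W D h = subst (λ E → length Z * 1 ≤ℕ E * ∑ Z _) (sym (ℕ.*-identityʳ D)) h
box-count {A = A} {I = I} xs T (suc k) Z W D h = begin
  length Z * (n ^ T * (n ^ T) ^ k)
    ≡⟨ ℕ.*-assoc (length Z) _ _ ⟨
  length Z * n ^ T * (n ^ T) ^ k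
    ≡⟨ cong (_* (n ^ T) ^ k) lengthZ₂ ⟨
  length Z₂ * (n ^ T) ^ k
    -- Each coordinate raises the inverse density to the power `T`, which accumulates to the
    -- exponent `T ^ k`.
    ≤⟨ box-count xs T k Z₂ W₂ (D ^ T) dense ⟩
  (D ^ T) ^ (T ^ k) * (∑[ b ← Z₂ ] ∑[ ts ← vecs (vecs xs T) k ] box (W₂ b) ts)
    ≡⟨ cong₂ _*_ (ℕ.^-*-assoc D T (T ^ k))
         (trans (∑-cartesianProductWith _,_ Z (vecs xs T) _)
                (∑-cong Z (λ a → sym (∑-vecs-suc (vecs xs T) k _)))) ⟩
  D ^ (T * T ^ k) * (∑[ a ← Z ] ∑[ ts ← vecs (vecs xs T) (suc k) ] box (W a) ts) ∎
  where
  open ℕ.≤-Reasoning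
  n : ℕ
  n = length xs
  -- `Z₁` indexes the lines parallel to the first axis and `d` is the weight of `W` on a line. The
  -- power mean is taken over `Z₁`; the `T`-th powers are then regrouped by the chosen `T`-tuple,
  -- giving `Z₂` and `W₂`.
  Z₁ : List (I × Vec A k)
  Z₁ = cartesianProduct Z (vecs xs k)
  d : I × Vec A k → ℕ
  d (a , z) = ∑[ x ← xs ] W a (x ∷ z)
  Z₂ : List (I × Vec A T)
  Z₂ = cartesianProduct Z (vecs xs T)
  W₂ : I × Vec A T → Vec A k → ℕ
  W₂ (a , t) z = ∏ (λ x → W a (x ∷ z)) t
  lengthZ₁ : length Z₁ ≡ length Z * n ^ k
  lengthZ₁ = trans (length-cartesianProductWith _,_ Z (vecs xs k)) (cong (length Z *_) (length-vecs xs k))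
  lengthZ₂ : length Z₂ ≡ length Z * n ^ T
  lengthZ₂ = trans (length-cartesianProductWith _,_ Z (vecs xs T)) (cong (length Z *_) (length-vecs xs T))
  ∑d : ∑ Z₁ d ≡ (∑[ a ← Z ] ∑[ z ← vecs xs (suc k) ] W a z)
  ∑d = trans (∑-cartesianProductWith _,_ Z (vecs xs k) d)
             (∑-cong Z (λ a → trans (∑-swap (vecs xs k) xs _) (sym (∑-vecs-suc xs k (W a)))))
  ∑dᵀ : (∑[ b ← Z₁ ] d b ^ T) ≡ (∑[ b ← Z₂ ] ∑[ z ← vecs xs k ] W₂ b z)
  ∑dᵀ = trans (∑-cartesianProductWith _,_ Z (vecs xs k) _)
       (trans (∑-cong Z (λ a → trans (∑-cong (vecs xs k) (λ z → sym (∑-∏ xs T _))) (∑-swap (vecs xs k) (vecs xs T) _)))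
              (sym (∑-cartesianProductWith _,_ Z (vecs xs T) _)))
  dense₁ : length Z₁ * n ≤ℕ D * ∑ Z₁ d
  dense₁ = begin
    length Z₁ * n          ≡⟨ cong (_* n) lengthZ₁ ⟩
    length Z * n ^ k * n   ≡⟨ ℕ.*-assoc (length Z) _ n ⟩
    length Z * (n ^ k * n) ≡⟨ cong (length Z *_) (ℕ.*-comm (n ^ k) n) ⟩
    length Z * n ^ suc k   ≤⟨ h ⟩
    D * _                  ≡⟨ cong (D *_) ∑d ⟨
    D * ∑ Z₁ d             ∎
  dense : length Z₂ * n ^ k ≤ℕ D ^ T * (∑[ b ← Z₂ ] ∑[ z ← vecs xs k ] W₂ b z)
  dense = begin
    length Z₂ * n ^ k        ≡⟨ cong (_* n ^ k) lengthZ₂ ⟩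
    length Z * n ^ T * n ^ k ≡⟨ eq (length Z) (n ^ T) (n ^ k) ⟩
    length Z * n ^ k * n ^ T ≡⟨ cong (_* n ^ T) lengthZ₁ ⟨
    length Z₁ * n ^ T        ≤⟨ power-mean Z₁ d n D T dense₁ ⟩
    D ^ T * (∑[ b ← Z₁ ] d b ^ T) ≡⟨ cong (D ^ T *_) ∑dᵀ ⟩
    D ^ T * _                ∎
    where
    eq : ∀ x y z → x * y * z ≡ x * z * y
    eq = solve-∀

-- Tuples with distinct entries

module _ {B : Set} (_≟_ : DecidableEquality B) where

  unique? : ∀ {r} (q : Vec B r) → Dec (Uniqueᵛ q)
  unique? = AllPairsᵛ.allPairs? (λ x y → ¬? (x ≟ y))

  occurrences : ∀ {r} → B → Vec B r → ℕ
  occurrences b []      = 0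
  occurrences b (c ∷ q) = 𝟙 (c ≟ b) + occurrences b q

  occurrences≡0 : ∀ {r} b (q : Vec B r) → occurrences b q ≡ 0 → Allᵛ (b ≢_) q
  occurrences≡0 b []      h = []
  occurrences≡0 b (c ∷ q) h with c ≟ b
  ... | no c≢b = (c≢b ∘ sym) ∷ occurrences≡0 b q h

  -- Prepending `b` destroys distinctness only when `b` occurs in `q`, and then `occurrences` is at
  -- least 1.
  unique-step : ∀ {r} b (q : Vec B r) → 𝟙 (unique? q) ≤ℕ 𝟙 (unique? (b ∷ q)) + occurrences b q
  unique-step b q with occurrences b q in eq
  ... | suc m = ℕ.≤-trans (𝟙≤1 (unique? q)) (ℕ.≤-trans (s≤s z≤n) (ℕ.m≤n+m _ _))
  ... | zero  = ℕ.≤-trans (𝟙-mono (unique? q) (unique? (b ∷ q)) (occurrences≡0 b q eq ∷_)) (ℕ.m≤m+n _ _)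

  module _ (xs : List A) (p : A → B) {m} (fibre : ∀ b → (∑[ x ← xs ] 𝟙 (b ≟ p x)) ≤ℕ m) where

    ∑-occurrences : ∀ {r} (q : Vec B r) → (∑[ x ← xs ] occurrences (p x) q) ≤ℕ r * m
    ∑-occurrences []      = ℕ.≤-reflexive (trans (∑-const xs 0) (ℕ.*-zeroʳ (length xs)))
    ∑-occurrences (c ∷ q) = ℕ.≤-trans (ℕ.≤-reflexive (∑-+ xs _ _)) (ℕ.+-mono-≤ (fibre c) (∑-occurrences q))

    -- A union bound: a random entry falls into the fibre of a given earlier one with probability at
    -- most `m` over the length of `xs`, hence at most 1/`R`, and `r * r` bounds the number of
    -- pairs.
    distinct-count : ∀ R → R * m ≤ℕ length xs → ∀ r →
      R * length xs ^ r ≤ℕ R * (∑[ z ← vecs xs r ] 𝟙 (unique? (Vec.map p z))) + r * r * length xs ^ r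
    distinct-count R h zero    = ℕ.≤-reflexive (sym (ℕ.+-identityʳ _))
    distinct-count R h (suc r) = begin
      R * (n * n ^ r)                                   ≡⟨ eq₁ R n (n ^ r) ⟩
      n * (R * n ^ r)                                   ≤⟨ ℕ.*-monoʳ-≤ n (distinct-count R h r) ⟩
      n * (R * N r + r * r * n ^ r)                     ≡⟨ eq₂ R n (N r) r (n ^ r) ⟩
      R * (n * N r) + r * r * (n * n ^ r)               ≤⟨ ℕ.+-monoˡ-≤ _ (ℕ.*-monoʳ-≤ R step) ⟩
      R * (N (suc r) + n ^ r * (r * m)) + r * r * (n * n ^ r) ≡⟨ eq₃ R (N (suc r)) (n ^ r) r m n ⟩
      R * N (suc r) + (n ^ r * r * (R * m) + r * r * (n * n ^ r)) ≤⟨ ℕ.+-monoʳ-≤ (R * N (suc r)) (ℕ.+-monoˡ-≤ _ (ℕ.*-monoʳ-≤ (n ^ r * r) h)) ⟩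
      -- The error coefficient is now `r * r + r`; a further `suc r` completes it to the square of
      -- `suc r`.
      R * N (suc r) + (n ^ r * r * n + r * r * (n * n ^ r)) ≤⟨ ℕ.m≤m+n _ (n * n ^ r * suc r) ⟩
      R * N (suc r) + (n ^ r * r * n + r * r * (n * n ^ r)) + n * n ^ r * suc r ≡⟨ eq₄ (R * N (suc r)) (n ^ r) r n ⟩
      R * N (suc r) + suc r * suc r * (n * n ^ r)       ∎
      where
      open ℕ.≤-Reasoning
      n : ℕ
      n = length xs
      N : ℕ → ℕ
      N r = ∑[ z ← vecs xs r ] 𝟙 (unique? (Vec.map p z))
      step : n * N r ≤ℕ N (suc r) + n ^ r * (r * m)
      step = begin
        n * N r
          ≡⟨ ∑-const xs (N r) ⟨
        (∑[ x ← xs ] N r)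
          ≤⟨ ∑-mono xs (λ x → ∑-mono (vecs xs r) (λ z → unique-step (p x) (Vec.map p z))) ⟩
        (∑[ x ← xs ] ∑[ z ← vecs xs r ] (𝟙 (unique? (p x ∷ Vec.map p z)) + occurrences (p x) (Vec.map p z)))
          ≡⟨ trans (∑-cong xs (λ x → ∑-+ (vecs xs r) _ _)) (∑-+ xs _ _) ⟩
        (∑[ x ← xs ] ∑[ z ← vecs xs r ] 𝟙 (unique? (p x ∷ Vec.map p z))) + (∑[ x ← xs ] ∑[ z ← vecs xs r ] occurrences (p x) (Vec.map p z))
          ≡⟨ cong₂ _+_ (sym (∑-vecs-suc xs r _)) (∑-swap xs (vecs xs r) _) ⟩
        N (suc r) + (∑[ z ← vecs xs r ] ∑[ x ← xs ] occurrences (p x) (Vec.map p z))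
          ≤⟨ ℕ.+-monoʳ-≤ (N (suc r)) (∑-≤-const (vecs xs r) (λ z → ∑-occurrences (Vec.map p z))) ⟩
        N (suc r) + length (vecs xs r) * (r * m)
          ≡⟨ cong (λ l → N (suc r) + l * (r * m)) (length-vecs xs r) ⟩
        N (suc r) + n ^ r * (r * m) ∎
      eq₁ : ∀ R n u → R * (n * u) ≡ n * (R * u)
      eq₁ = solve-∀
      eq₂ : ∀ R n N r u → n * (R * N + r * r * u) ≡ R * (n * N) + r * r * (n * u)
      eq₂ = solve-∀
      eq₃ : ∀ R N u r m n → R * (N + u * (r * m)) + r * r * (n * u) ≡ R * N + (u * r * (R * m) + r * r * (n * u))
      eq₃ = solve-∀
      eq₄ : ∀ M u r n → M + (u * r * n + r * r * (n * u)) + n * u * suc r ≡ M + suc r * suc r * (n * u)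
      eq₄ = solve-∀

-- Tuples with prescribed entries

𝟙-* : ∀ {P Q R : Set} (p : Dec P) (q : Dec Q) (r : Dec R) → (P → Q → R) → 𝟙 p * 𝟙 q ≤ℕ 𝟙 r
𝟙-* (no _)  q       r h = z≤n
𝟙-* (yes _) (no _)  r h = z≤n
𝟙-* (yes p) (yes q) r h = ℕ.≤-reflexive (sym (𝟙-true r (h p q)))

map-lookup-update : ∀ {k r} (x : Vec A k) c b (q : Vec (Fin k) r) → Allᵛ (c ≢_) q →
                    Vec.map (lookup (x [ c ]≔ b)) q ≡ Vec.map (lookup x) q
map-lookup-update x c b []      []          = refl
map-lookup-update x c b (i ∷ q) (c≢i ∷ c∉q) =
  cong₂ _∷_ (Vec.lookup∘update′ (c≢i ∘ sym) x b) (map-lookup-update x c b q c∉q)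

module _ (_≟_ : DecidableEquality A) {xs : List A} (u : Uniqueˡ xs) (complete : ∀ x → x ∈ˡ xs) where

  -- Independence for a random tuple: invariance under updates at `c` says that `F` ignores this
  -- coordinate, so prescribing it divides the sum by the number of values.
  ∑-fix-coordinate : ∀ {k} (c : Fin k) a (F : Vec A k → ℕ) → (∀ x b → F (x [ c ]≔ b) ≡ F x) →
    length xs * (∑[ x ← vecs xs k ] 𝟙 (a ≟ lookup x c) * F x) ≡ ∑ (vecs xs k) F
  ∑-fix-coordinate {suc k} zero a F inv = begin
    length xs * (∑[ x ← vecs xs (suc k) ] 𝟙 (a ≟ lookup x zero) * F x)
      ≡⟨ cong (length xs *_) (trans (∑-vecs-suc xs k _) (∑-cong xs (λ y → trans (∑-*ˡ (vecs xs k) (𝟙 (a ≟ y)) _) (cong (𝟙 (a ≟ y) *_) (slice y))))) ⟩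
    length xs * (∑[ y ← xs ] 𝟙 (a ≟ y) * S)
      ≡⟨ cong (length xs *_) (trans (∑-*ʳ xs S _) (trans (cong (_* S) (∑𝟙-≡ _≟_ u (complete a))) (ℕ.*-identityˡ S))) ⟩
    length xs * S
      ≡⟨ ∑-const xs S ⟨
    (∑[ y ← xs ] S)
      ≡⟨ ∑-cong xs (λ y → sym (slice y)) ⟩
    (∑[ y ← xs ] ∑[ z ← vecs xs k ] F (y ∷ z))
      ≡⟨ ∑-vecs-suc xs k F ⟨
    ∑ (vecs xs (suc k)) F ∎
    where
    open ≡-Reasoning
    S : ℕ
    S = ∑[ z ← vecs xs k ] F (a ∷ z)
    slice : ∀ y → (∑[ z ← vecs xs k ] F (y ∷ z)) ≡ S
    slice y = ∑-cong (vecs xs k) (λ z → inv (a ∷ z) y)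
  ∑-fix-coordinate {suc k} (suc c) a F inv = begin
    length xs * (∑[ x ← vecs xs (suc k) ] 𝟙 (a ≟ lookup x (suc c)) * F x)
      ≡⟨ cong (length xs *_) (∑-vecs-suc xs k _) ⟩
    length xs * (∑[ y ← xs ] ∑[ z ← vecs xs k ] 𝟙 (a ≟ lookup z c) * F (y ∷ z))
      ≡⟨ ∑-*ˡ xs (length xs) _ ⟨
    (∑[ y ← xs ] length xs * (∑[ z ← vecs xs k ] 𝟙 (a ≟ lookup z c) * F (y ∷ z)))
      ≡⟨ ∑-cong xs (λ y → ∑-fix-coordinate c a (λ z → F (y ∷ z)) (λ z b → inv (y ∷ z) b)) ⟩
    (∑[ y ← xs ] ∑[ z ← vecs xs k ] F (y ∷ z))
      ≡⟨ ∑-vecs-suc xs k F ⟨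
    ∑ (vecs xs (suc k)) F ∎
    where open ≡-Reasoning

  -- A random tuple takes prescribed values at `r` distinct coordinates with probability at least
  -- one over the `r`-th power of the number of values. Coordinates are peeled off one by one;
  -- distinctness makes the remaining condition ignore the one removed.
  prescribed-count : ∀ {k r} (q : Vec (Fin k) r) (e : Vec A r) → Uniqueᵛ q →
    length xs ^ k ≤ℕ length xs ^ r * (∑[ x ← vecs xs k ] 𝟙 (Vec.≡-dec _≟_ e (Vec.map (lookup x) q)))
  prescribed-count {k} []      []      _           = ℕ.≤-reflexive (begin
    length xs ^ k                 ≡⟨ length-vecs xs k ⟨
    length (vecs xs k)            ≡⟨ ℕ.*-identityʳ _ ⟨
    length (vecs xs k) * 1        ≡⟨ ∑-const (vecs xs k) 1 ⟨
    (∑[ _ ← vecs xs k ] 1)        ≡⟨ ℕ.+-identityʳ _ ⟨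
    (∑[ _ ← vecs xs k ] 1) + 0    ∎)
    where open ≡-Reasoning
  prescribed-count {k} {suc r} (c ∷ q) (a ∷ e) (c∉q ∷ uq) = begin
    n ^ k
      ≤⟨ prescribed-count q e uq ⟩
    n ^ r * (∑[ x ← vecs xs k ] F x)
      ≡⟨ cong (n ^ r *_) (∑-fix-coordinate c a F (λ x b → cong (λ w → 𝟙 (Vec.≡-dec _≟_ e w)) (map-lookup-update x c b q c∉q))) ⟨
    n ^ r * (n * (∑[ x ← vecs xs k ] 𝟙 (a ≟ lookup x c) * F x))
      ≡⟨ trans (sym (ℕ.*-assoc (n ^ r) n _)) (cong (_* (∑[ x ← vecs xs k ] 𝟙 (a ≟ lookup x c) * F x)) (ℕ.*-comm (n ^ r) n)) ⟩
    n ^ suc r * (∑[ x ← vecs xs k ] 𝟙 (a ≟ lookup x c) * F x)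
      ≤⟨ ℕ.*-monoʳ-≤ (n ^ suc r) (∑-mono (vecs xs k) (λ x → 𝟙-* (a ≟ lookup x c) (Vec.≡-dec _≟_ e _) (Vec.≡-dec _≟_ (a ∷ e) _) (cong₂ _∷_))) ⟩
    n ^ suc r * (∑[ x ← vecs xs k ] 𝟙 (Vec.≡-dec _≟_ (a ∷ e) (lookup x c ∷ Vec.map (lookup x) q))) ∎
    where
    open ℕ.≤-Reasoning
    n : ℕ
    n = length xs
    F : Vec A k → ℕ
    F x = 𝟙 (Vec.≡-dec _≟_ e (Vec.map (lookup x) q))

-- Images of subsets

private variable
  n n₀ n₁ : ℕ

InjectiveOn : (Fin n₀ → Fin n) → Subset n₀ → Set
InjectiveOn f F = ∀ i j → i ∈ F → j ∈ F → f i ≡ f j → i ≡ j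

injectiveOn? : ∀ (f : Fin n₀ → Fin n) F → Dec (InjectiveOn f F)
injectiveOn? f F = Fin.all? λ i → Fin.all? λ j → (i ∈? F) →-dec ((j ∈? F) →-dec ((f i Fin.≟ f j) →-dec (i Fin.≟ j)))

∈-image⁺ : ∀ (f : Fin n₀ → Fin n) {F i j} → i ∈ F → f i ≡ j → j ∈ image f F
∈-image⁺ f {F} {i} {j} i∈F fi≡j = Vec.lookup⇒[]= j (image f F)
  (trans (Vec.lookup∘tabulate _ j) (dec-true (Fin.any? λ i → (i ∈? F) ×-dec (f i Fin.≟ j)) (i , i∈F , fi≡j)))

∈-image⁻ : ∀ (f : Fin n₀ → Fin n) F {j} → j ∈ image f F → ∃ λ i → i ∈ F × f i ≡ j
∈-image⁻ f F {j} j∈ =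
  witness (Fin.any? λ i → (i ∈? F) ×-dec (f i Fin.≟ j)) (trans (sym (Vec.lookup∘tabulate _ j)) (Vec.[]=⇒lookup j∈))
  where
  witness : ∀ {P : Set} (d : Dec P) → does d ≡ true → P
  witness (yes p) _ = p

image-∘ : ∀ (g : Fin n₀ → Fin n) (f : Fin n₁ → Fin n₀) F → image g (image f F) ≡ image (g ∘ f) F
image-∘ g f F = ⊆-antisym to from
  where
  to : ∀ {j} → j ∈ image g (image f F) → j ∈ image (g ∘ f) F
  to j∈ with i , i∈ , refl ← ∈-image⁻ g (image f F) j∈ with k , k∈ , refl ← ∈-image⁻ f F i∈ = ∈-image⁺ (g ∘ f) k∈ refl
  from : ∀ {j} → j ∈ image (g ∘ f) F → j ∈ image g (image f F)
  from j∈ with k , k∈ , refl ← ∈-image⁻ (g ∘ f) F j∈ = ∈-image⁺ g (∈-image⁺ f k∈ refl) refl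

image-cong : ∀ {f g : Fin n₀ → Fin n} {F} → (∀ i → i ∈ F → f i ≡ g i) → image f F ≡ image g F
image-cong {f = f} {g} {F} h = ⊆-antisym to from
  where
  to : ∀ {j} → j ∈ image f F → j ∈ image g F
  to j∈ with i , i∈ , refl ← ∈-image⁻ f F j∈ = ∈-image⁺ g i∈ (sym (h i i∈))
  from : ∀ {j} → j ∈ image g F → j ∈ image f F
  from j∈ with i , i∈ , refl ← ∈-image⁻ g F j∈ = ∈-image⁺ f i∈ (h i i∈)

∑-allFin-suc : ∀ n f → ∑ (allFin (suc n)) f ≡ f zero + ∑ (allFin n) (f ∘ suc)
∑-allFin-suc n f = cong (f zero +_) (trans (cong (λ xs → ∑ xs f) (sym (List.map-tabulate id suc))) (∑-map suc (allFin n) f))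

𝟙-⇔ : ∀ {P Q : Set} (p : Dec P) (q : Dec Q) → (P → Q) → (Q → P) → 𝟙 p ≡ 𝟙 q
𝟙-⇔ p q f g = ℕ.≤-antisym (𝟙-mono p q f) (𝟙-mono q p g)

∣∣≡∑ : ∀ (X : Subset n) → ∣ X ∣ˢ ≡ (∑[ i ← allFin n ] 𝟙 (i ∈? X))
∣∣≡∑ []                  = refl
∣∣≡∑ {suc n} (inside ∷ X)  = trans (cong suc (∣∣≡∑ X)) (sym (trans (∑-allFin-suc n (λ i → 𝟙 (i ∈? (inside ∷ X))))
  (cong suc (∑-cong (allFin n) (λ i → 𝟙-⇔ (suc i ∈? (inside ∷ X)) (i ∈? X) drop-there there)))))
∣∣≡∑ {suc n} (outside ∷ X) = trans (∣∣≡∑ X) (sym (trans (∑-allFin-suc n (λ i → 𝟙 (i ∈? (outside ∷ X))))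
  (∑-cong (allFin n) (λ i → 𝟙-⇔ (suc i ∈? (outside ∷ X)) (i ∈? X) drop-there there))))

-- Count the pairs of an `i` in `F` and its value `f i` in both orders; injectivity on `F` gives
-- each value a single preimage.
∣image∣ : ∀ (f : Fin n₀ → Fin n) F → InjectiveOn f F → ∣ image f F ∣ˢ ≡ ∣ F ∣ˢ
∣image∣ {n₀} {n} f F inj = begin
  ∣ image f F ∣ˢ                                   ≡⟨ ∣∣≡∑ (image f F) ⟩
  (∑[ j ← allFin n ] 𝟙 (j ∈? image f F))          ≡⟨ ∑-cong (allFin n) (λ j → sym (overPreimages j)) ⟩
  (∑[ j ← allFin n ] ∑[ i ← allFin n₀ ] 𝟙 (R? i j)) ≡⟨ ∑-swap (allFin n) (allFin n₀) _ ⟩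
  (∑[ i ← allFin n₀ ] ∑[ j ← allFin n ] 𝟙 (R? i j)) ≡⟨ ∑-cong (allFin n₀) overValues ⟩
  (∑[ i ← allFin n₀ ] 𝟙 (i ∈? F))                  ≡⟨ ∣∣≡∑ F ⟨
  ∣ F ∣ˢ                                           ∎
  where
  open ≡-Reasoning
  R? : ∀ i j → Dec (i ∈ F × f i ≡ j)
  R? i j = (i ∈? F) ×-dec (f i Fin.≟ j)
  overPreimages : ∀ j → (∑[ i ← allFin n₀ ] 𝟙 (R? i j)) ≡ 𝟙 (j ∈? image f F)
  overPreimages j = ∑𝟙-exactlyOne (λ i → R? i j) (Uniqueˡ.allFin⁺ n₀)
    (λ (p , e) (p' , e') → inj _ _ p p' (trans e (sym e'))) (j ∈? image f F)
    (λ (p , e) → ∈-image⁺ f p e) (λ j∈ → let i , r = ∈-image⁻ f F j∈ in i , Membership.∈-allFin i , r)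
  overValues : ∀ i → (∑[ j ← allFin n ] 𝟙 (R? i j)) ≡ 𝟙 (i ∈? F)
  overValues i = ∑𝟙-exactlyOne (R? i) (Uniqueˡ.allFin⁺ n)
    (λ (_ , e) (_ , e') → trans (sym e) e') (i ∈? F) proj₁ (λ i∈ → f i , Membership.∈-allFin _ , i∈ , refl)

elements : ∀ (X : Subset n) → Σ (Vec (Fin n) ∣ X ∣ˢ) λ e →
           Uniqueᵛ e × (∀ i → lookup e i ∈ X) × (∀ {j} → j ∈ X → ∃ λ i → lookup e i ≡ j)
elements []            = [] , [] , (λ ()) , λ ()
elements (outside ∷ X) with e , u , e∈ , onto ← elements X =
  Vec.map suc e , Uniqueᵛ.map⁺ Fin.suc-injective u ,
  (λ i → subst (_∈ (outside ∷ X)) (sym (Vec.lookup-map i suc e)) (there (e∈ i))) ,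
  λ { (there j∈) → let i , eq = onto j∈ in i , trans (Vec.lookup-map i suc e) (cong suc eq) }
elements (inside ∷ X) with e , u , e∈ , onto ← elements X =
  zero ∷ Vec.map suc e , zero∉ e ∷ Uniqueᵛ.map⁺ Fin.suc-injective u ,
  (λ { zero → here ; (suc i) → subst (_∈ (inside ∷ X)) (sym (Vec.lookup-map i suc e)) (there (e∈ i)) }) ,
  λ { here → zero , refl ; (there j∈) → let i , eq = onto j∈ in suc i , trans (Vec.lookup-map i suc e) (cong suc eq) }
  where
  zero∉ : ∀ {r} (e : Vec (Fin _) r) → Allᵛ (zero ≢_) (Vec.map suc e)
  zero∉ []      = []
  zero∉ (_ ∷ e) = (λ ()) ∷ zero∉ e

-- Weights

subsets : ∀ n → List (Subset n)
subsets = vecs (outside ∷ inside ∷ [])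

subsets-unique : ∀ n → Uniqueˡ (subsets n)
subsets-unique = vecs-unique (((λ ()) ∷ []) ∷ [] ∷ [])

∈-subsets : ∀ (X : Subset n) → X ∈ˡ subsets n
∈-subsets = ∈-vecs λ { false → here refl ; true → there (here refl) }

_≟ˢ_ : DecidableEquality (Subset n)
_≟ˢ_ = Vec.≡-dec Bool._≟_

-- Splitting by whether the first vertex belongs to the subset gives Pascal's rule.
subset-count : ∀ n r → (∑[ X ← subsets n ] 𝟙 (∣ X ∣ˢ ℕ.≟ r)) ≡ n C r
subset-count zero    zero    = refl
subset-count zero    (suc r) = refl
subset-count (suc n) r = begin
  (∑[ X ← subsets (suc n) ] 𝟙 (∣ X ∣ˢ ℕ.≟ r))
    ≡⟨ ∑-vecs-suc (outside ∷ inside ∷ []) n _ ⟩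
  (∑[ X ← subsets n ] 𝟙 (∣ X ∣ˢ ℕ.≟ r)) + ((∑[ X ← subsets n ] 𝟙 (suc ∣ X ∣ˢ ℕ.≟ r)) + 0)
    ≡⟨ cong₂ _+_ (subset-count n r) (ℕ.+-identityʳ _) ⟩
  n C r + (∑[ X ← subsets n ] 𝟙 (suc ∣ X ∣ˢ ℕ.≟ r))
    ≡⟨ pascal r ⟩
  suc n C r ∎
  where
  open ≡-Reasoning
  nC0≡1 : ∀ n → n C 0 ≡ 1
  nC0≡1 n = trans (nCk≡nC[n∸k] {k = 0} {n = n} z≤n) (nCn≡1 n)
  pascal : ∀ r → n C r + (∑[ X ← subsets n ] 𝟙 (suc ∣ X ∣ˢ ℕ.≟ r)) ≡ suc n C r
  pascal zero    = trans (cong₂ _+_ (nC0≡1 n) (∑𝟙-none (λ X → suc ∣ X ∣ˢ ℕ.≟ 0) (subsets n) (λ _ ()))) (sym (nC0≡1 (suc n)))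
  pascal (suc r) = begin
    n C suc r + (∑[ X ← subsets n ] 𝟙 (suc ∣ X ∣ˢ ℕ.≟ suc r))
      ≡⟨ cong (n C suc r +_) (∑-cong (subsets n) (λ X → 𝟙-⇔ (suc ∣ X ∣ˢ ℕ.≟ suc r) (∣ X ∣ˢ ℕ.≟ r) ℕ.suc-injective (cong suc))) ⟩
    n C suc r + (∑[ X ← subsets n ] 𝟙 (∣ X ∣ˢ ℕ.≟ r))
      ≡⟨ cong (n C suc r +_) (subset-count n r) ⟩
    n C suc r + n C r
      ≡⟨ ℕ.+-comm (n C suc r) (n C r) ⟩
    n C r + n C suc r
      ≡⟨ nCk+nC[k+1]≡[n+1]C[k+1] n r ⟩
    suc n C suc r ∎

C*k![n∸k]!≡n! : ∀ {n k} → k ≤ℕ n → (n C k) * (k ! * (n ∸ k) !) ≡ n !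
C*k![n∸k]!≡n! {n} {k} k≤n = trans (cong (_* (k ! * (n ∸ k) !)) (nCk≡n!/k![n-k]! k≤n))
  (m/n*n≡m {{ℕ._!*_!≢0 k (n ∸ k)}} (k![n∸k]!∣n! k≤n))

C*k![n∸k]!≤n! : ∀ n k → (n C k) * (k ! * (n ∸ k) !) ≤ℕ n !
C*k![n∸k]!≤n! n k with ℕ.≤-<-connex k n
... | inj₁ k≤n = ℕ.≤-reflexive (C*k![n∸k]!≡n! k≤n)
... | inj₂ k>n rewrite k>n⇒nCk≡0 k>n = z≤n

-- n ! times the weight 1 / (n C ∣ F ∣ˢ) of F in h.
weight : Subset n → ℕ
weight {n} F = ∣ F ∣ˢ ! * (n ∸ ∣ F ∣ˢ) !

-- The edges of one size weigh at most `n !` together, and only `suc v` sizes occur. This is the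
-- trivial density bound, used for all error terms.
∑weight≤ : ∀ {G : List (Subset n)} {v} → Uniqueˡ G → (∀ {F} → F ∈ˡ G → ∣ F ∣ˢ ≤ℕ v) → ∑ G weight ≤ℕ suc v * n !
∑weight≤ {n} {G} {v} u bound = begin
  ∑ G weight
    ≤⟨ ∑-mono-∈ G (λ {F} F∈ → ℕ.≤-trans (ℕ.≤-reflexive (sym (trans (cong (_* w ∣ F ∣ˢ) (𝟙-true (∣ F ∣ˢ ℕ.≟ ∣ F ∣ˢ) refl)) (ℕ.*-identityˡ _))))
         (term≤∑ (λ r → 𝟙 (∣ F ∣ˢ ℕ.≟ r) * w r) (Membership.∈-upTo⁺ (s≤s (bound F∈))))) ⟩
  (∑[ F ← G ] ∑[ r ← upTo (suc v) ] 𝟙 (∣ F ∣ˢ ℕ.≟ r) * w r)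
    ≡⟨ ∑-swap G (upTo (suc v)) _ ⟩
  (∑[ r ← upTo (suc v) ] ∑[ F ← G ] 𝟙 (∣ F ∣ˢ ℕ.≟ r) * w r)
    ≡⟨ ∑-cong (upTo (suc v)) (λ r → ∑-*ʳ G (w r) _) ⟩
  (∑[ r ← upTo (suc v) ] (∑[ F ← G ] 𝟙 (∣ F ∣ˢ ℕ.≟ r)) * w r)
    ≤⟨ ∑-≤-const (upTo (suc v)) perSize ⟩
  length (upTo (suc v)) * n !
    ≡⟨ cong (_* n !) (List.length-upTo (suc v)) ⟩
  suc v * n ! ∎
  where
  open ℕ.≤-Reasoning
  w : ℕ → ℕ
  w r = r ! * (n ∸ r) !
  perSize : ∀ r → (∑[ F ← G ] 𝟙 (∣ F ∣ˢ ℕ.≟ r)) * w r ≤ℕ n !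
  perSize r = begin
    (∑[ F ← G ] 𝟙 (∣ F ∣ˢ ℕ.≟ r)) * w r
      ≤⟨ ℕ.*-monoˡ-≤ (w r) (∑𝟙-inject (λ F → ∣ F ∣ˢ ℕ.≟ r) (λ F → ∣ F ∣ˢ ℕ.≟ r) _≟ˢ_ u (subsets-unique n) ∈-subsets id id (λ _ _ e → e)) ⟩
    (∑[ F ← subsets n ] 𝟙 (∣ F ∣ˢ ℕ.≟ r)) * w r
      ≡⟨ cong (_* w r) (subset-count n r) ⟩
    (n C r) * w r
      ≤⟨ C*k![n∸k]!≤n! n r ⟩
    n ! ∎

-- Pulling back a hypergraph along a map of vertices

-- Injectivity on `X` gives `X` the size of its image, so pulling back preserves edge sizes and, on
-- equally many vertices, weights.
Pulled : (Fin n₀ → Fin n) → List (Subset n) → Subset n₀ → Set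
Pulled φ G X = InjectiveOn φ X × image φ X ∈ˡ G

pulled? : ∀ (φ : Fin n₀ → Fin n) G X → Dec (Pulled φ G X)
pulled? φ G X = injectiveOn? φ X ×-dec member? _≟ˢ_ (image φ X) G

pull : (Fin n₀ → Fin n) → List (Subset n) → List (Subset n₀)
pull {n₀} φ G = filter (pulled? φ G) (subsets n₀)

copy? : ∀ (φ : Fin n₀ → Fin n) X Y → Dec (InjectiveOn φ X × image φ X ≡ Y)
copy? φ X Y = injectiveOn? φ X ×-dec (image φ X ≟ˢ Y)

copies : (Fin n₀ → Fin n) → Subset n → ℕ
copies {n₀} φ Y = ∑[ X ← subsets n₀ ] 𝟙 (copy? φ X Y)

∑-filter : ∀ {P : A → Set} (P? : Decidable P) xs f → ∑ (filter P? xs) f ≡ (∑[ x ← xs ] 𝟙 (P? x) * f x)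
∑-filter P? []       f = refl
∑-filter P? (x ∷ xs) f with P? x
... | yes _ = cong₂ _+_ (sym (ℕ.*-identityˡ (f x))) (∑-filter P? xs f)
... | no  _ = ∑-filter P? xs f

-- Double counting of pairs of an edge `Y` and a set `X` mapped injectively onto it: both have the
-- same weight, and `X` determines `Y`.
∑weight-pull : ∀ (φ : Fin n → Fin n) {G} → Uniqueˡ G → (∑[ Y ← G ] weight Y * copies φ Y) ≤ℕ ∑ (pull φ G) weight
∑weight-pull {n} φ {G} u = begin
  (∑[ Y ← G ] weight Y * copies φ Y)
    ≡⟨ ∑-cong G (λ Y → sym (∑-*ˡ (subsets n) (weight Y) _)) ⟩
  (∑[ Y ← G ] ∑[ X ← subsets n ] weight Y * 𝟙 (copy? φ X Y))
    ≡⟨ ∑-swap G (subsets n) _ ⟩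
  (∑[ X ← subsets n ] ∑[ Y ← G ] weight Y * 𝟙 (copy? φ X Y))
    ≡⟨ ∑-cong (subsets n) (λ X → trans (∑-cong G (sameWeight X)) (∑-*ʳ G (weight X) _)) ⟩
  (∑[ X ← subsets n ] (∑[ Y ← G ] 𝟙 (copy? φ X Y)) * weight X)
    ≤⟨ ∑-mono (subsets n) (λ X → ℕ.*-monoˡ-≤ (weight X) (atMostOne X)) ⟩
  (∑[ X ← subsets n ] 𝟙 (pulled? φ G X) * weight X)
    ≡⟨ ∑-filter (pulled? φ G) (subsets n) weight ⟨
  ∑ (pull φ G) weight ∎
  where
  open ℕ.≤-Reasoning
  sameWeight : ∀ X Y → weight Y * 𝟙 (copy? φ X Y) ≡ 𝟙 (copy? φ X Y) * weight X
  sameWeight X Y with copy? φ X Y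
  ... | no  _            = ℕ.*-zeroʳ (weight Y)
  ... | yes (inj , refl) rewrite ∣image∣ φ X inj = ℕ.*-comm (weight X) 1
  atMostOne : ∀ X → (∑[ Y ← G ] 𝟙 (copy? φ X Y)) ≤ℕ 𝟙 (pulled? φ G X)
  atMostOne X with member? _≟ˢ_ (image φ X) G
  ... | yes i = ∑𝟙-atMostOne (copy? φ X) u (λ (_ , e) (_ , e') → trans (sym e) e') (injectiveOn? φ X ×-dec yes i) (λ (inj , _) → inj , i)
  ... | no ¬i = ℕ.≤-trans (ℕ.≤-reflexive (∑𝟙-none (copy? φ X) G (λ { Y∈ (_ , refl) → ¬i Y∈ }))) z≤n

-- A copy of Y is the image of a section of φ over Y.
sections≤copies : ∀ (φ : Fin n₀ → Fin n) (Y : Subset n) →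
  (∑[ g ← points n₀ ∣ Y ∣ˢ ] 𝟙 (Vec.≡-dec Fin._≟_ (proj₁ (elements Y)) (Vec.map φ g))) ≤ℕ copies φ Y
sections≤copies {n₀} {n} φ Y with e , u , e∈ , onto ← elements Y =
  ∑𝟙-inject (λ g → Vec.≡-dec Fin._≟_ e (Vec.map φ g)) (λ X → copy? φ X Y) _≟ˢ_
    (points-unique n₀ ∣ Y ∣ˢ) (subsets-unique n₀) ∈-subsets
    (λ g → image (lookup g) ⊤) (λ {g} → isCopy g) (λ {g} {g'} → inj g g')
  where
  over : ∀ g → e ≡ Vec.map φ g → ∀ a → lookup e a ≡ φ (lookup g a)
  over g refl a = Vec.lookup-map a φ g
  index : ∀ g → e ≡ Vec.map φ g → ∀ g' → e ≡ Vec.map φ g' → ∀ a b → φ (lookup g a) ≡ φ (lookup g' b) → a ≡ b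
  index g eg g' eg' a b h = Uniqueᵛ.lookup-injective u a b (trans (over g eg a) (trans h (sym (over g' eg' b))))
  isCopy : ∀ g → e ≡ Vec.map φ g → InjectiveOn φ (image (lookup g) ⊤) × image φ (image (lookup g) ⊤) ≡ Y
  isCopy g eg = injective , trans (image-∘ φ (lookup g) ⊤) (⊆-antisym to from)
    where
    injective : InjectiveOn φ (image (lookup g) ⊤)
    injective i j i∈ j∈ h
      with a , _ , refl ← ∈-image⁻ (lookup g) ⊤ i∈ with b , _ , refl ← ∈-image⁻ (lookup g) ⊤ j∈ =
      cong (lookup g) (index g eg g eg a b h)
    to : ∀ {j} → j ∈ image (φ ∘ lookup g) ⊤ → j ∈ Y
    to j∈ with a , _ , refl ← ∈-image⁻ (φ ∘ lookup g) ⊤ j∈ = subst (_∈ Y) (over g eg a) (e∈ a)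
    from : ∀ {j} → j ∈ Y → j ∈ image (φ ∘ lookup g) ⊤
    from j∈ with a , refl ← onto j∈ = ∈-image⁺ (φ ∘ lookup g) ∈⊤ (sym (over g eg a))
  -- The entries of `e` are distinct, so each element of the section's image is matched to its index
  -- by its value under `φ`; the image thus determines the section.
  inj : ∀ g g' → e ≡ Vec.map φ g → e ≡ Vec.map φ g' → image (lookup g) ⊤ ≡ image (lookup g') ⊤ → g ≡ g'
  inj g g' eg eg' h = trans (sym (Vec.tabulate∘lookup g)) (trans (Vec.tabulate-cong same) (Vec.tabulate∘lookup g'))
    where
    same : ∀ a → lookup g a ≡ lookup g' a
    same a with b , _ , gb ← ∈-image⁻ (lookup g') ⊤ (subst (lookup g a ∈_) h (∈-image⁺ (lookup g) (∈⊤ {x = a}) refl))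
      with refl ← index g eg g' eg' a b (cong φ (sym gb)) = sym gb

-- Balanced maps and the expected number of copies of an edge

balanced-map : ∀ R {n} → .{{NonZero R}} → 2 * R ≤ℕ n →
  Σ (Fin n → Fin (2 * R)) λ p → ∃ λ m → (∀ c → (∑[ j ← allFin n ] 𝟙 (c Fin.≟ p j)) ≤ℕ m) × R * m ≤ℕ n
balanced-map R {n} 2R≤n = p , m , fibre , ℕ.*-cancelˡ-≤ 2 double
  where
  instance
    2R≢0 : NonZero (2 * R)
    2R≢0 = ℕ.m*n≢0 2 R
  -- Rounding the part size up costs at most `2 * R` vertices in total, which is at most `n`. With
  -- `2 * R` parts this gives `2 * (R * m) ≤ 2 * n`.
  m : ℕ
  m = suc (n / (2 * R))
  n≤ : n ≤ℕ 2 * R * m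
  n≤ = begin
    n                                                 ≡⟨ m≡m%n+[m/n]*n n (2 * R) ⟩
    _ + n / (2 * R) * (2 * R)                         ≤⟨ ℕ.+-monoˡ-≤ _ (ℕ.<⇒≤ (m%n<n n (2 * R))) ⟩
    2 * R + n / (2 * R) * (2 * R)                     ≡⟨ cong (2 * R +_) (ℕ.*-comm (n / (2 * R)) (2 * R)) ⟩
    2 * R + 2 * R * (n / (2 * R))                     ≡⟨ ℕ.*-suc (2 * R) _ ⟨
    2 * R * m                                         ∎
    where open ℕ.≤-Reasoning
  double : 2 * (R * m) ≤ℕ 2 * n
  double = begin
    2 * (R * m)                     ≡⟨ eq R (n / (2 * R)) ⟩
    2 * R + n / (2 * R) * (2 * R)   ≤⟨ ℕ.+-mono-≤ 2R≤n (ℕ.≤-trans (ℕ.m≤n+m _ _) (ℕ.≤-reflexive (sym (m≡m%n+[m/n]*n n (2 * R))))) ⟩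
    n + n                           ≡⟨ cong (n +_) (ℕ.+-identityʳ n) ⟨
    2 * n                           ∎
    where
    open ℕ.≤-Reasoning
    eq : ∀ R q → 2 * (R * suc q) ≡ 2 * R + q * (2 * R)
    eq = solve-∀
  -- Division by `m`: the quotient is the part, and the remainder embeds each part into `Fin m`.
  place : Fin n → Fin (2 * R) × Fin m
  place j = remQuot m (inject≤ j n≤)
  p : Fin n → Fin (2 * R)
  p = proj₁ ∘ place
  place-injective : ∀ i j → place i ≡ place j → i ≡ j
  place-injective i j h = Fin.inject≤-injective n≤ n≤ i j (begin
    inject≤ i n≤                          ≡⟨ Fin.combine-remQuot {2 * R} m (inject≤ i n≤) ⟨
    combine (proj₁ (place i)) (proj₂ (place i)) ≡⟨ cong (λ (a , b) → combine a b) h ⟩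
    combine (proj₁ (place j)) (proj₂ (place j)) ≡⟨ Fin.combine-remQuot {2 * R} m (inject≤ j n≤) ⟩
    inject≤ j n≤                          ∎)
    where open ≡-Reasoning
  fibre : ∀ c → (∑[ j ← allFin n ] 𝟙 (c Fin.≟ p j)) ≤ℕ m
  fibre c = begin
    (∑[ j ← allFin n ] 𝟙 (c Fin.≟ p j))
      ≤⟨ ∑𝟙-inject (λ j → c Fin.≟ p j) (λ _ → yes tt) Fin._≟_ (Uniqueˡ.allFin⁺ n) (Uniqueˡ.allFin⁺ m) Membership.∈-allFin
           (proj₂ ∘ place) (λ _ → tt) (λ {i} {j} ci cj h → place-injective i j (cong₂ _,_ (trans (sym ci) cj) h)) ⟩
    (∑[ _ ← allFin m ] 1)
      ≡⟨ ∑-const (allFin m) 1 ⟩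
    length (allFin m) * 1
      ≡⟨ trans (ℕ.*-identityʳ _) (length-allFin m) ⟩
    m ∎
    where open ℕ.≤-Reasoning

module _ {n k} (p : Fin n → Fin k) {m} (fibre : ∀ c → (∑[ j ← allFin n ] 𝟙 (c Fin.≟ p j)) ≤ℕ m)
         (R : ℕ) .{{_ : NonZero R}} .{{_ : NonZero n}} (Rm≤n : R * m ≤ℕ n) where

  -- The expected number of copies of `Y` is at least 1 - 1/`D`. All but a fraction 1/`D` of the
  -- `r`-tuples meet distinct parts of `p`, and each of these is a section over `Y` for at least a
  -- fraction 1/`n ^ r` of the `x`.
  copies-count : ∀ D {v} → D * (v * v) ≤ℕ R → (Y : Subset n) → ∣ Y ∣ˢ ≤ℕ v →
    D * n ^ k ≤ℕ D * (∑[ x ← points n k ] copies (lookup x ∘ p) Y) + n ^ k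
  copies-count D {v} Dv²≤R Y Y≤v = ℕ.*-cancelˡ-≤ (n ^ r) {{ℕ.m^n≢0 n r}} (begin
    n ^ r * (D * n ^ k)            ≡⟨ eq₁ (n ^ r) D (n ^ k) ⟩
    D * n ^ r * n ^ k              ≤⟨ ℕ.*-monoˡ-≤ (n ^ k) mostDistinct ⟩
    (D * N + n ^ r) * n ^ k        ≡⟨ eq₂ D N (n ^ r) (n ^ k) ⟩
    D * (N * n ^ k) + n ^ r * n ^ k ≤⟨ ℕ.+-monoˡ-≤ _ (ℕ.*-monoʳ-≤ D fromSections) ⟩
    D * (n ^ r * S) + n ^ r * n ^ k ≡⟨ eq₃ D (n ^ r) S (n ^ k) ⟩
    n ^ r * (D * S + n ^ k)        ∎)
    where
    open ℕ.≤-Reasoning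
    r : ℕ
    r = ∣ Y ∣ˢ
    e : Vec (Fin n) r
    e = proj₁ (elements Y)
    N S : ℕ
    N = ∑[ g ← points n r ] 𝟙 (unique? Fin._≟_ (Vec.map p g))
    S = ∑[ x ← points n k ] copies (lookup x ∘ p) Y
    mostDistinct : D * n ^ r ≤ℕ D * N + n ^ r
    mostDistinct = ℕ.*-cancelˡ-≤ R (begin
      R * (D * n ^ r)                       ≡⟨ eq₄ R D (n ^ r) ⟩
      D * (R * n ^ r)                       ≤⟨ ℕ.*-monoʳ-≤ D count ⟩
      D * (R * N + r * r * n ^ r)           ≡⟨ eq₅ D R N (r * r) (n ^ r) ⟩
      R * (D * N) + D * (r * r) * n ^ r     ≤⟨ ℕ.+-monoʳ-≤ (R * (D * N)) (ℕ.*-monoˡ-≤ (n ^ r) (ℕ.≤-trans (ℕ.*-monoʳ-≤ D (ℕ.*-mono-≤ Y≤v Y≤v)) Dv²≤R)) ⟩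
      R * (D * N) + R * n ^ r               ≡⟨ ℕ.*-distribˡ-+ R _ _ ⟨
      R * (D * N + n ^ r)                   ∎)
      where
      count : R * n ^ r ≤ℕ R * N + r * r * n ^ r
      count = subst (λ l → R * l ^ r ≤ℕ R * N + r * r * l ^ r) (length-allFin n)
        (distinct-count Fin._≟_ (allFin n) p fibre R (subst (R * m ≤ℕ_) (sym (length-allFin n)) Rm≤n) r)
      eq₄ : ∀ R D u → R * (D * u) ≡ D * (R * u)
      eq₄ = solve-∀
      eq₅ : ∀ D R N q u → D * (R * N + q * u) ≡ R * (D * N) + D * q * u
      eq₅ = solve-∀
    hits : Vec (Fin n) r → ℕ
    hits g = ∑[ x ← points n k ] 𝟙 (Vec.≡-dec Fin._≟_ e (Vec.map (lookup x) (Vec.map p g)))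
    perSection : ∀ g → 𝟙 (unique? Fin._≟_ (Vec.map p g)) * n ^ k ≤ℕ n ^ r * hits g
    perSection g with unique? Fin._≟_ (Vec.map p g)
    ... | no  _ = z≤n
    ... | yes u = ℕ.≤-trans (ℕ.≤-reflexive (ℕ.*-identityˡ (n ^ k)))
      (subst (λ l → l ^ k ≤ℕ l ^ r * hits g) (length-allFin n)
        (prescribed-count Fin._≟_ (Uniqueˡ.allFin⁺ n) Membership.∈-allFin (Vec.map p g) e u))
    fromSections : N * n ^ k ≤ℕ n ^ r * S
    fromSections = begin
      N * n ^ k
        ≡⟨ ∑-*ʳ (points n r) (n ^ k) _ ⟨
      (∑[ g ← points n r ] 𝟙 (unique? Fin._≟_ (Vec.map p g)) * n ^ k)
        ≤⟨ ∑-mono (points n r) perSection ⟩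
      (∑[ g ← points n r ] n ^ r * hits g)
        ≡⟨ ∑-*ˡ (points n r) (n ^ r) _ ⟩
      n ^ r * (∑[ g ← points n r ] ∑[ x ← points n k ] 𝟙 (Vec.≡-dec Fin._≟_ e (Vec.map (lookup x) (Vec.map p g))))
        ≡⟨ cong (n ^ r *_) (∑-swap (points n r) (points n k) _) ⟩
      n ^ r * (∑[ x ← points n k ] ∑[ g ← points n r ] 𝟙 (Vec.≡-dec Fin._≟_ e (Vec.map (lookup x) (Vec.map p g))))
        ≡⟨ cong (n ^ r *_) (∑-cong (points n k) (λ x → ∑-cong (points n r) (λ g → cong (λ w → 𝟙 (Vec.≡-dec Fin._≟_ e w)) (sym (Vec.map-∘ (lookup x) p g))))) ⟩
      n ^ r * (∑[ x ← points n k ] ∑[ g ← points n r ] 𝟙 (Vec.≡-dec Fin._≟_ e (Vec.map (lookup x ∘ p) g)))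
        ≤⟨ ℕ.*-monoʳ-≤ (n ^ r) (∑-mono (points n k) (λ x → sections≤copies (lookup x ∘ p) Y)) ⟩
      n ^ r * S ∎
    eq₁ : ∀ u D w → u * (D * w) ≡ D * u * w
    eq₁ = solve-∀
    eq₂ : ∀ D N u w → (D * N + u) * w ≡ D * (N * w) + u * w
    eq₂ = solve-∀
    eq₃ : ∀ D u S w → D * (u * S) + u * w ≡ u * (D * S + w)
    eq₃ = solve-∀

-- Homomorphisms through a k-tuple of vertices

-- Injectivity is imposed on edges only: `x` may repeat vertices, and `f` may identify vertices of
-- `H` that share no edge.
Hom : ∀ {k} (H : Hypergraph) → List (Subset n) → Vec (Fin k) (v H) → Vec (Fin n) k → Set
Hom H G f x = ∀ F → E H F → Pulled (lookup x ∘ lookup f) G F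

-- `f` records the part of `p` containing each vertex of the copy. This leaves only `k ^ v H`
-- candidates for `f`, a number independent of `n`.
pull⊇⇒Hom : ∀ {k} H (G : List (Subset n)) (p : Fin n → Fin k) x → SubgraphOf H (asHG n (pull (lookup x ∘ p) G)) → ∃ λ f → Hom H G f x
pull⊇⇒Hom H G p x (g , g-inj , g-edge) = Vec.tabulate (p ∘ g) , hom
  where
  same : ∀ i → lookup x (lookup (Vec.tabulate (p ∘ g)) i) ≡ lookup x (p (g i))
  same i = cong (lookup x) (Vec.lookup∘tabulate (p ∘ g) i)
  hom : Hom H G (Vec.tabulate (p ∘ g)) x
  hom F EF with _ , inj , edge ← Membership.∈-filter⁻ (pulled? (lookup x ∘ p) G) {xs = subsets _} (g-edge F EF) =
    (λ i j i∈ j∈ h → g-inj (inj (g i) (g j) (∈-image⁺ g i∈ refl) (∈-image⁺ g j∈ refl)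
                                (trans (sym (same i)) (trans h (same j))))) ,
    subst (_∈ˡ G) (trans (image-∘ (lookup x ∘ p) g F) (image-cong {F = F} (λ i _ → sym (same i)))) edge

-- f need not be injective: vertices of H with the same image l under f are sent to
-- different entries of the tuple ts l, which has room for all vertices of the blowup.
-- The extra entry of each tuple serves as a default.
box⇒blowup : ∀ {k} H s (G : List (Subset n)) (f : Vec (Fin k) (v H)) (ts : Vec (Vec (Fin n) (suc (v H * s))) k) →
  Uniqueᵛ (Vec.concat ts) → (∀ c → Hom H G f (Vec.zipWith lookup ts c)) → SubgraphOf (blowup H s) (asHG n G)
box⇒blowup {n} {k} H s G f ts u hom = g , g-injective , g-edge
  where
  entry : Fin k → Fin (suc (v H * s)) → Fin n
  entry l c = lookup (lookup ts l) c
  entry-injective : ∀ l c l' c' → entry l c ≡ entry l' c' → l ≡ l' × c ≡ c'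
  entry-injective l c l' c' h = Fin.combine-injective l c l' c' (Uniqueᵛ.lookup-injective u _ _
    (trans (Vec.lookup-concat ts l c) (trans h (sym (Vec.lookup-concat ts l' c')))))
  -- The position `suc w` is different for every vertex `w` of the blowup, so `g` is injective even
  -- where `f` is not; position `zero` stays free.
  g : Fin (v H * s) → Fin n
  g w = entry (lookup f (quotient s w)) (suc w)
  g-injective : Injective _≡_ _≡_ g
  g-injective h = Fin.suc-injective (proj₂ (entry-injective _ _ _ _ h))
  lookup-pick : ∀ c l → lookup (Vec.zipWith lookup ts (Vec.tabulate c)) l ≡ entry l (c l)
  lookup-pick c l = trans (Vec.lookup-zipWith lookup l ts (Vec.tabulate c)) (cong (entry l) (Vec.lookup∘tabulate c l))
  -- Composed with the point of the box at constant position `zero`, `f` is injective on `F`, hence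
  -- `f` itself is.
  f-injectiveOn : ∀ F → E H F → InjectiveOn (lookup f) F
  f-injectiveOn F EF i j i∈ j∈ h = proj₁ (hom (Vec.replicate k zero) F EF) i j i∈ j∈ (cong (lookup (Vec.zipWith lookup ts (Vec.replicate k zero))) h)
  g-edge : ∀ X → E (blowup H s) X → image g X ∈ˡ G
  g-edge _ (F , EF , c , refl) = subst (_∈ˡ G)
    (trans (image-cong same) (sym (image-∘ g (λ i → combine i (c i)) F)))
    (proj₂ (hom (Vec.tabulate choice) F EF))
    where
    choose : ∀ {l} → Dec (∃ λ i → i ∈ F × lookup f i ≡ l) → Fin (suc (v H * s))
    choose (yes (i , _)) = suc (combine i (c i))
    choose (no _)        = zero
    choice : Fin k → Fin (suc (v H * s))
    choice l = choose (Fin.any? λ i → (i ∈? F) ×-dec (lookup f i Fin.≟ l))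
    -- The search may return another vertex of `F` over the same part; injectivity of `f` on `F`
    -- identifies it with `i`.
    choose-f : ∀ i → i ∈ F → (d : Dec (∃ λ i' → i' ∈ F × lookup f i' ≡ lookup f i)) → choose d ≡ suc (combine i (c i))
    choose-f i i∈ (yes (i' , i'∈ , h)) = cong (λ j → suc (combine j (c j))) (f-injectiveOn F EF i' i i'∈ i∈ h)
    choose-f i i∈ (no ¬∃)              = contradiction (i , i∈ , refl) ¬∃
    same : ∀ i → i ∈ F → lookup (Vec.zipWith lookup ts (Vec.tabulate choice)) (lookup f i) ≡ g (combine i (c i))
    same i i∈ = begin
      lookup (Vec.zipWith lookup ts (Vec.tabulate choice)) (lookup f i) ≡⟨ lookup-pick choice (lookup f i) ⟩
      entry (lookup f i) (choice (lookup f i))                          ≡⟨ cong (entry (lookup f i)) (choose-f i i∈ _) ⟩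
      entry (lookup f i) (suc (combine i (c i)))                        ≡⟨ cong (λ j → entry (lookup f j) (suc (combine i (c i)))) (cong proj₁ (Fin.remQuot-combine i (c i))) ⟨
      g (combine i (c i))                                               ∎
      where open ≡-Reasoning

module _ {k : ℕ} (H : Hypergraph) (s : ℕ) (G : List (Subset n)) (free : ¬ SubgraphOf (blowup H s) (asHG n G))
         (hom? : ∀ (f : Vec (Fin k) (v H)) (x : Vec (Fin n) k) → Dec (Hom H G f x)) where

  private
    T : ℕ
    T = suc (v H * s)

  -- Otherwise `box-count` makes at least a fraction 1/`D ^ (T ^ k)` of all boxes consist of
  -- homomorphisms. Boxes with a repeated vertex form a fraction of at most `(k * T)` squared over
  -- `n`, so for large `n` some such box has distinct entries and yields the blowup.
  few-homs : ∀ D → D ^ (T ^ k) * (k * T * (k * T)) <ℕ n →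
             ∀ f → D * (∑[ x ← points n k ] 𝟙 (hom? f x)) ≤ℕ n ^ k
  few-homs D n-large f = ℕ.≮⇒≥ λ dense → ℕ.<⇒≱ n-large (n≤ (ℕ.<⇒≤ dense))
    where
    W : Vec (Fin n) k → ℕ
    W x = 𝟙 (hom? f x)
    M : ℕ
    M = k * T
    boxes distinct : ℕ
    boxes    = ∑[ ts ← vecs (points n T) k ] box W ts
    -- `Vec.map id` fits the form of `distinct-count`, applied below to the identity map with fibres
    -- of size 1.
    distinct = ∑[ z ← points n M ] 𝟙 (unique? Fin._≟_ (Vec.map id z))

    𝟙≢0 : ∀ {P : Set} (d : Dec P) → 𝟙 d ≢ 0 → P
    𝟙≢0 (yes p) _ = p
    𝟙≢0 (no _)  h = contradiction refl h

    exclusive : ∀ ts → box W ts + 𝟙 (unique? Fin._≟_ (Vec.map id (Vec.concat ts))) ≤ℕ 1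
    exclusive ts with unique? Fin._≟_ (Vec.map id (Vec.concat ts))
    ... | no _  = ℕ.≤-trans (ℕ.≤-reflexive (ℕ.+-identityʳ _)) (box≤1 (λ x → 𝟙≤1 (hom? f x)) ts)
    ... | yes u with box W ts ℕ.≟ 0
    ...   | yes b≡0 = ℕ.≤-reflexive (cong (_+ 1) b≡0)
    ...   | no  b≢0 = contradiction
      (box⇒blowup H s G f ts (subst Uniqueᵛ (Vec.map-id (Vec.concat ts)) u) (λ c → 𝟙≢0 (hom? f _) (box≢0 W ts b≢0 c))) free

    boxes+distinct≤ : boxes + distinct ≤ℕ n ^ M
    boxes+distinct≤ = begin
      boxes + distinct
        ≡⟨ cong (boxes +_) (∑-vecs-concat (allFin n) k T _) ⟨
      boxes + (∑[ ts ← vecs (points n T) k ] 𝟙 (unique? Fin._≟_ (Vec.map id (Vec.concat ts))))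
        ≡⟨ ∑-+ (vecs (points n T) k) _ _ ⟨
      (∑[ ts ← vecs (points n T) k ] (box W ts + 𝟙 (unique? Fin._≟_ (Vec.map id (Vec.concat ts)))))
        ≤⟨ ∑-≤-const (vecs (points n T) k) exclusive ⟩
      length (vecs (points n T) k) * 1
        ≡⟨ trans (ℕ.*-identityʳ _) (trans (length-vecs (points n T) k) (cong (_^ k) (length-points n T))) ⟩
      (n ^ T) ^ k
        ≡⟨ trans (ℕ.^-*-assoc n T k) (cong (n ^_) (ℕ.*-comm T k)) ⟩
      n ^ M ∎
      where open ℕ.≤-Reasoning

    instance
      n≢0 : NonZero n
      n≢0 = >-nonZero (ℕ.≤-<-trans z≤n n-large)

    few-boxes : n * boxes ≤ℕ M * M * n ^ M
    few-boxes = ℕ.+-cancelʳ-≤ (n * distinct) _ _ (begin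
      n * boxes + n * distinct            ≡⟨ ℕ.*-distribˡ-+ n boxes distinct ⟨
      n * (boxes + distinct)              ≤⟨ ℕ.*-monoʳ-≤ n boxes+distinct≤ ⟩
      n * n ^ M                           ≤⟨ count ⟩
      n * distinct + M * M * n ^ M        ≡⟨ ℕ.+-comm (n * distinct) _ ⟩
      M * M * n ^ M + n * distinct        ∎)
      where
      open ℕ.≤-Reasoning
      fibre : ∀ (c : Fin n) → (∑[ x ← allFin n ] 𝟙 (c Fin.≟ x)) ≤ℕ 1
      fibre c = ℕ.≤-reflexive (∑𝟙-≡ Fin._≟_ (Uniqueˡ.allFin⁺ n) (Membership.∈-allFin c))
      count : n * n ^ M ≤ℕ n * distinct + M * M * n ^ M
      count = subst (λ l → n * l ^ M ≤ℕ n * distinct + M * M * l ^ M) (length-allFin n)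
        (distinct-count Fin._≟_ (allFin n) id fibre n (ℕ.≤-reflexive (trans (ℕ.*-identityʳ n) (sym (length-allFin n)))) M)

    n≤ : n ^ k ≤ℕ D * (∑[ x ← points n k ] W x) → n ≤ℕ D ^ (T ^ k) * (M * M)
    n≤ dense = ℕ.*-cancelʳ-≤ n _ (n ^ M) {{ℕ.m^n≢0 n M}} (begin
      n * n ^ M                          ≡⟨ cong (n *_) (trans (cong (n ^_) (ℕ.*-comm k T)) (sym (ℕ.^-*-assoc n T k))) ⟩
      n * (n ^ T) ^ k                    ≤⟨ ℕ.*-monoʳ-≤ n many-boxes ⟩
      n * (D ^ (T ^ k) * boxes)          ≡⟨ eq n (D ^ (T ^ k)) boxes ⟩
      D ^ (T ^ k) * (n * boxes)          ≤⟨ ℕ.*-monoʳ-≤ (D ^ (T ^ k)) few-boxes ⟩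
      D ^ (T ^ k) * (M * M * n ^ M)      ≡⟨ ℕ.*-assoc (D ^ (T ^ k)) (M * M) (n ^ M) ⟨
      D ^ (T ^ k) * (M * M) * n ^ M      ∎)
      where
      open ℕ.≤-Reasoning
      eq : ∀ n d b → n * (d * b) ≡ d * (n * b)
      eq = solve-∀
      many-boxes : (n ^ T) ^ k ≤ℕ D ^ (T ^ k) * boxes
      many-boxes = begin
        (n ^ T) ^ k                       ≡⟨ ℕ.+-identityʳ _ ⟨
        -- A parameter set with one element starts the induction of `box-count`.
        1 * (n ^ T) ^ k                   ≤⟨ subst (λ l → 1 * (l ^ T) ^ k ≤ℕ D ^ (T ^ k) * (boxes + 0)) (length-allFin n)
                                               (box-count (allFin n) T k (tt ∷ []) (λ _ → W) D (begin
                                                 1 * length (allFin n) ^ k     ≡⟨ trans (ℕ.*-identityˡ _) (cong (_^ k) (length-allFin n)) ⟩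
                                                 n ^ k                         ≤⟨ dense ⟩
                                                 D * ∑ (points n k) W          ≡⟨ cong (D *_) (ℕ.+-identityʳ _) ⟨
                                                 D * (∑ (points n k) W + 0)    ∎)) ⟩
        D ^ (T ^ k) * (boxes + 0)         ≡⟨ cong (D ^ (T ^ k) *_) (ℕ.+-identityʳ boxes) ⟩
        D ^ (T ^ k) * boxes               ∎

-- Admissibility

pull-admissible : ∀ H (G : List (Subset n)) (φ : Fin n → Fin n) → RSub (asHG n G) H →
                  ¬ SubgraphOf H (asHG n (pull φ G)) → Admissible H n (pull φ G)
pull-admissible {n} H G φ rsub free = Uniqueˡ.filter⁺ (pulled? φ G) (subsets-unique n) , rsub' , free
  where
  rsub' : RSub (asHG n (pull φ G)) H
  rsub' X X∈ with _ , inj , Y∈ ← Membership.∈-filter⁻ (pulled? φ G) {xs = subsets n} X∈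
    with F , EF , eq ← rsub (image φ X) Y∈ = F , EF , trans eq (∣image∣ φ X inj)

∣transversal∣ : ∀ {m s} (c : Fin m → Fin s) F → ∣ image (λ i → combine i (c i)) F ∣ˢ ≡ ∣ F ∣ˢ
∣transversal∣ c F = ∣image∣ _ F (λ i j _ _ h → proj₁ (Fin.combine-injective i (c i) j (c j) h))

RSub-blowup⁻ : ∀ H s {G} → RSub G (blowup H s) → RSub G H
RSub-blowup⁻ H s rsub X X∈ with _ , (F , EF , c , refl) , eq ← rsub X X∈ = F , EF , trans (sym (∣transversal∣ c F)) eq

-- The first vertices of the classes span a copy of `H` in the blowup, and an edge of `H` has the
-- size of its transversals.
blowup-admissible : ∀ H s {G} → Admissible H n G → Admissible (blowup H (suc s)) n G
blowup-admissible H s {G} (u , rsub , free) = u , rsub' , free'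
  where
  first : Fin (v H) → Fin (v H * suc s)
  first i = combine i zero
  rsub' : RSub (asHG _ G) (blowup H (suc s))
  rsub' X X∈ with F , EF , eq ← rsub X X∈ =
    image first F , (F , EF , (λ _ → zero) , refl) , trans (∣transversal∣ (λ _ → zero) F) eq
  free' : ¬ SubgraphOf (blowup H (suc s)) (asHG _ G)
  free' (g , g-inj , g-edge) = free (g ∘ first ,
    (λ h → proj₁ (Fin.combine-injective _ _ _ _ (g-inj h))) ,
    λ F EF → subst (_∈ˡ G) (image-∘ g first F) (g-edge _ (F , EF , (λ _ → zero) , refl)))

-- The comparison of densities, multiplied by n !

-- Of the form `2 * R`, as in `balanced-map`, with `R` nonzero and at least `D * (v * v)`, as in
-- `copies-count`.
parts : ℕ → ℕ → ℕ
parts v D = 2 * suc (D * (v * v))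

-- The bound in `few-homs` with `D * k ^ v` for `D`, since the homomorphisms are summed over all
-- `k ^ v` maps `f`.
boxThreshold : ℕ → ℕ → ℕ → ℕ
boxThreshold v s D = (D * k ^ v) ^ (T ^ k) * (k * T * (k * T))
  where
  k T : ℕ
  k = parts v D
  T = suc (v * s)

-- The `suc` serves the strict inequality of `few-homs`, and the last summand gives `balanced-map`
-- at least as many vertices as parts.
threshold : ℕ → ℕ → ℕ → ℕ
threshold v s D = suc (boxThreshold v s D) + parts v D

module _ (H : Hypergraph) (s D : ℕ) (n-large : threshold (v H) s D ≤ℕ n)
         (E? : ∀ F → Dec (E H F)) where

  hom? : ∀ {k} (G : List (Subset n)) (f : Vec (Fin k) (v H)) x → Dec (Hom H G f x)
  hom? G f x with anySubset? (λ F → E? F ×-dec ¬? (pulled? (lookup x ∘ lookup f) G F))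
  ... | yes (F , EF , ¬p) = no (λ hom → ¬p (hom F EF))
  ... | no ¬∃             = yes (λ F EF → decidable-stable (pulled? _ G F) (λ ¬p → ¬∃ (F , EF , ¬p)))

  -- Average the weight of the pullback over `x`. Sections lose at most a fraction 1/`D` of the
  -- weight of `G`, and exceptional `x`, whose pullback may contain `H`, contribute at most `M` each
  -- and have density at most 1/`D`. These are the two error terms `M`.
  ∑weight-blowup-free : ∀ {G B} → Admissible (blowup H s) n G →
    (∀ G' → Admissible H n G' → ∑ G' weight ≤ℕ B) →
    D * ∑ G weight ≤ℕ D * B + 2 * (suc (v H) * n !)
  ∑weight-blowup-free {G} {B} (u , rsubˢ , free) bound
    with p , m , fibre , Rm≤n ← balanced-map (suc (D * (v H * v H))) (ℕ.≤-trans (ℕ.m≤n+m _ (suc (boxThreshold (v H) s D))) n-large) =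
    ℕ.*-cancelˡ-≤ N {{ℕ.m^n≢0 n k}} (begin
      N * (D * ∑ G weight)
        ≡⟨ trans (sym (∑-*ˡ-2 N D)) (∑-cong G (λ Y → eq₁ N D (weight Y))) ⟩
      (∑[ Y ← G ] weight Y * (D * N))
        ≤⟨ ∑-mono-∈ G (λ {Y} Y∈ → ℕ.*-monoʳ-≤ (weight Y) (copies-count p fibre _ Rm≤n D (ℕ.n≤1+n _) Y (size Y∈))) ⟩
      (∑[ Y ← G ] weight Y * (D * (∑[ x ← xs ] copies (φ p x) Y) + N))
        ≡⟨ trans (∑-cong G (λ Y → eq₂ (weight Y) D (∑[ x ← xs ] copies (φ p x) Y) N)) (∑-+ G _ _) ⟩
      (∑[ Y ← G ] D * (weight Y * (∑[ x ← xs ] copies (φ p x) Y))) + (∑[ Y ← G ] N * weight Y)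
        ≡⟨ cong₂ _+_ (∑-*ˡ G D _) (∑-*ˡ G N weight) ⟩
      D * (∑[ Y ← G ] weight Y * (∑[ x ← xs ] copies (φ p x) Y)) + N * ∑ G weight
        ≡⟨ cong (λ S → D * S + N * ∑ G weight) (trans (∑-cong G (λ Y → sym (∑-*ˡ xs (weight Y) _))) (∑-swap G xs _)) ⟩
      D * (∑[ x ← xs ] ∑[ Y ← G ] weight Y * copies (φ p x) Y) + N * ∑ G weight
        ≤⟨ ℕ.+-mono-≤ (ℕ.*-monoʳ-≤ D (∑-mono xs (λ x → ℕ.≤-trans (∑weight-pull (φ p x) u) (weight-pull≤ p x))))
                      (ℕ.*-monoʳ-≤ N (∑weight≤ u size)) ⟩
      D * (∑[ x ← xs ] (B + homs x * M)) + N * M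
        ≡⟨ cong (λ S → D * S + N * M) (trans (∑-+ xs _ _) (cong₂ _+_ (trans (∑-const xs B) (cong (_* B) (length-points n k))) (∑-*ʳ xs M homs))) ⟩
      D * (N * B + ∑ xs homs * M) + N * M
        ≡⟨ eq₃ D N B (∑ xs homs) M ⟩
      N * (D * B) + D * ∑ xs homs * M + N * M
        ≤⟨ ℕ.+-monoˡ-≤ (N * M) (ℕ.+-monoʳ-≤ (N * (D * B)) (ℕ.*-monoˡ-≤ M few)) ⟩
      N * (D * B) + N * M + N * M
        ≡⟨ eq₄ N (D * B) M ⟩
      N * (D * B + 2 * M) ∎)
    where
    open ℕ.≤-Reasoning
    k N M : ℕ
    k = parts (v H) D
    N = n ^ k
    M = suc (v H) * n !
    xs : List (Vec (Fin n) k)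
    xs = points n k
    φ : (Fin n → Fin k) → Vec (Fin n) k → Fin n → Fin n
    φ p x = lookup x ∘ p
    instance
      n≢0 : NonZero n
      n≢0 = >-nonZero (ℕ.≤-trans (s≤s z≤n) n-large)
    rsub : RSub (asHG n G) H
    rsub = RSub-blowup⁻ H s rsubˢ
    size : ∀ {F} → F ∈ˡ G → ∣ F ∣ˢ ≤ℕ v H
    size {F} F∈ with F' , _ , eq ← rsub F F∈ = subst (_≤ℕ v H) eq (∣p∣≤n F')
    homs : Vec (Fin n) k → ℕ
    homs x = ∑[ f ← points k (v H) ] 𝟙 (hom? G f x)
    -- Each of the `k ^ v H` maps `f` accounts for at most a fraction 1/(`D * k ^ v H`) of the
    -- tuples.
    few : D * ∑ xs homs ≤ℕ N
    few = ℕ.*-cancelˡ-≤ (k ^ v H) {{ℕ.m^n≢0 k (v H)}} (begin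
      k ^ v H * (D * ∑ xs homs)
        ≡⟨ trans (sym (ℕ.*-assoc (k ^ v H) D _)) (cong₂ _*_ (ℕ.*-comm (k ^ v H) D) (∑-swap xs (points k (v H)) _)) ⟩
      D * k ^ v H * (∑[ f ← points k (v H) ] ∑[ x ← xs ] 𝟙 (hom? G f x))
        ≡⟨ ∑-*ˡ (points k (v H)) (D * k ^ v H) _ ⟨
      (∑[ f ← points k (v H) ] D * k ^ v H * (∑[ x ← xs ] 𝟙 (hom? G f x)))
        ≤⟨ ∑-≤-const (points k (v H)) (few-homs H s G free (hom? G) (D * k ^ v H) (ℕ.≤-trans (ℕ.m≤m+n _ k) n-large)) ⟩
      length (points k (v H)) * N
        ≡⟨ cong (_* N) (length-points k (v H)) ⟩
      k ^ v H * N ∎)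
    -- If `homs x` vanishes, the pullback is `H`-free and `bound` applies; otherwise `homs x` is at
    -- least 1 and the trivial bound `M` suffices.
    weight-pull≤ : ∀ p x → ∑ (pull (φ p x) G) weight ≤ℕ B + homs x * M
    weight-pull≤ p x with homs x in eq
    ... | zero  = ℕ.≤-trans (bound _ (pull-admissible H G (φ p x) rsub pull-free)) (ℕ.m≤m+n B 0)
      where
      pull-free : ¬ SubgraphOf H (asHG n (pull (φ p x) G))
      pull-free sub with f , hom ← pull⊇⇒Hom H G p x sub =
        ℕ.<⇒≱ (ℕ.≤-reflexive (sym (𝟙-true (hom? G f x) hom)))
              (ℕ.≤-trans (term≤∑ (λ f → 𝟙 (hom? G f x)) (∈-points f)) (ℕ.≤-reflexive eq))
    ... | suc c = begin
      ∑ (pull (φ p x) G) weight  ≤⟨ ∑weight≤ (Uniqueˡ.filter⁺ (pulled? (φ p x) G) (subsets-unique n)) pull-size ⟩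
      M                          ≤⟨ ℕ.m≤m+n M (c * M) ⟩
      suc c * M                  ≤⟨ ℕ.m≤n+m _ B ⟩
      B + suc c * M              ∎
      where
      pull-size : ∀ {X} → X ∈ˡ pull (φ p x) G → ∣ X ∣ˢ ≤ℕ v H
      pull-size {X} X∈ with _ , inj , Y∈ ← Membership.∈-filter⁻ (pulled? (φ p x) G) {xs = subsets n} X∈ =
        subst (_≤ℕ v H) (∣image∣ (φ p x) X inj) (size Y∈)
    ∑-*ˡ-2 : ∀ c d → (∑[ Y ← G ] c * (d * weight Y)) ≡ c * (d * ∑ G weight)
    ∑-*ˡ-2 c d = trans (∑-*ˡ G c _) (cong (c *_) (∑-*ˡ G d weight))
    eq₁ : ∀ N D w → N * (D * w) ≡ w * (D * N)
    eq₁ = solve-∀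
    eq₂ : ∀ w D S N → w * (D * S + N) ≡ D * (w * S) + N * w
    eq₂ = solve-∀
    eq₃ : ∀ D N B S M → D * (N * B + S * M) + N * M ≡ N * (D * B) + D * S * M + N * M
    eq₃ = solve-∀
    eq₄ : ∀ N X M → N * X + N * M + N * M ≡ N * (X + 2 * M)
    eq₄ = solve-∀

-- Densities as rational numbers

open import Data.Integer using (+_; +[1+_]; -[1+_])

fromℚᵘ-homo-+ : ∀ p q → fromℚᵘ (p ℚᵘ.+ q) ≡ fromℚᵘ p ℚ.+ fromℚᵘ q
fromℚᵘ-homo-+ p q = ℚ.toℚᵘ-injective (begin
  toℚᵘ (fromℚᵘ (p ℚᵘ.+ q))                 ≈⟨ ℚ.toℚᵘ-fromℚᵘ (p ℚᵘ.+ q) ⟩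
  p ℚᵘ.+ q                                 ≈⟨ ℚᵘ.+-cong (ℚ.toℚᵘ-fromℚᵘ p) (ℚ.toℚᵘ-fromℚᵘ q) ⟨
  toℚᵘ (fromℚᵘ p) ℚᵘ.+ toℚᵘ (fromℚᵘ q)     ≈⟨ ℚ.toℚᵘ-homo-+ (fromℚᵘ p) (fromℚᵘ q) ⟨
  toℚᵘ (fromℚᵘ p ℚ.+ fromℚᵘ q)             ∎)
  where open import Relation.Binary.Reasoning.Setoid ℚᵘ.≃-setoid

fromℚᵘ-homo-* : ∀ p q → fromℚᵘ (p ℚᵘ.* q) ≡ fromℚᵘ p ℚ.* fromℚᵘ q
fromℚᵘ-homo-* p q = ℚ.toℚᵘ-injective (begin
  toℚᵘ (fromℚᵘ (p ℚᵘ.* q))                 ≈⟨ ℚ.toℚᵘ-fromℚᵘ (p ℚᵘ.* q) ⟩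
  p ℚᵘ.* q                                 ≈⟨ ℚᵘ.*-cong (ℚ.toℚᵘ-fromℚᵘ p) (ℚ.toℚᵘ-fromℚᵘ q) ⟨
  toℚᵘ (fromℚᵘ p) ℚᵘ.* toℚᵘ (fromℚᵘ q)     ≈⟨ ℚ.toℚᵘ-homo-* (fromℚᵘ p) (fromℚᵘ q) ⟨
  toℚᵘ (fromℚᵘ p ℚ.* fromℚᵘ q)             ∎)
  where open import Relation.Binary.Reasoning.Setoid ℚᵘ.≃-setoid

fromℚᵘ-mono-≤ : ∀ {p q} → p ℚᵘ.≤ q → fromℚᵘ p ≤ fromℚᵘ q
fromℚᵘ-mono-≤ {p} {q} p≤q = ℚ.toℚᵘ-cancel-≤
  (ℚᵘ.≤-respˡ-≃ (ℚᵘ.≃-sym (ℚ.toℚᵘ-fromℚᵘ p)) (ℚᵘ.≤-respʳ-≃ (ℚᵘ.≃-sym (ℚ.toℚᵘ-fromℚᵘ q)) p≤q))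

fromℚᵘ-cancel-≤ : ∀ {p q} → fromℚᵘ p ≤ fromℚᵘ q → p ℚᵘ.≤ q
fromℚᵘ-cancel-≤ {p} {q} p≤q =
  ℚᵘ.≤-respˡ-≃ (ℚ.toℚᵘ-fromℚᵘ p) (ℚᵘ.≤-respʳ-≃ (ℚ.toℚᵘ-fromℚᵘ q) (ℚ.toℚᵘ-mono-≤ p≤q))

fromℕᵘ : ℕ → ℚᵘ
fromℕᵘ m = mkℚᵘ (+ m) 0

-- Passing through unnormalised rationals reduces the arithmetic laws to integer identities.
fromℕ : ℕ → ℚ
fromℕ = fromℚᵘ ∘ fromℕᵘ

fromℕ-+ : ∀ m n → fromℕ (m + n) ≡ fromℕ m ℚ.+ fromℕ n
fromℕ-+ m n = trans
  (ℚ.fromℚᵘ-cong {fromℕᵘ (m + n)} {fromℕᵘ m ℚᵘ.+ fromℕᵘ n} (*≡* (cong (ℤ._* + 1) (begin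
    + (m + n)                          ≡⟨ ℤ.pos-+ m n ⟩
    + m ℤ.+ + n                        ≡⟨ cong₂ ℤ._+_ (ℤ.*-identityʳ (+ m)) (ℤ.*-identityʳ (+ n)) ⟨
    + m ℤ.* + 1 ℤ.+ + n ℤ.* + 1        ∎))))
  (fromℚᵘ-homo-+ (fromℕᵘ m) (fromℕᵘ n))
  where open ≡-Reasoning

fromℕ-* : ∀ m n → fromℕ (m * n) ≡ fromℕ m ℚ.* fromℕ n
fromℕ-* m n = trans
  (ℚ.fromℚᵘ-cong {fromℕᵘ (m * n)} {fromℕᵘ m ℚᵘ.* fromℕᵘ n} (*≡* (cong (ℤ._* + 1) (ℤ.pos-* m n))))
  (fromℚᵘ-homo-* (fromℕᵘ m) (fromℕᵘ n))

fromℕ-mono-≤ : ∀ {m n} → m ≤ℕ n → fromℕ m ≤ fromℕ n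
fromℕ-mono-≤ {m} {n} m≤n = fromℚᵘ-mono-≤ {fromℕᵘ m} {fromℕᵘ n} (*≤* (ℤ.*-monoʳ-≤-nonNeg (+ 1) (ℤ.+≤+ m≤n)))

fromℕ-cancel-≤ : ∀ {m n} → fromℕ m ≤ fromℕ n → m ≤ℕ n
fromℕ-cancel-≤ {m} {n} h with *≤* le ← fromℚᵘ-cancel-≤ {fromℕᵘ m} {fromℕᵘ n} h =
  ℤ.drop‿+≤+ (subst₂ ℤ._≤_ (ℤ.*-identityʳ (+ m)) (ℤ.*-identityʳ (+ n)) le)

fromℕ-positive : ∀ m → .{{NonZero m}} → Positive (fromℕ m)
fromℕ-positive m = ℚ.normalize-pos m 1

fromℕ-nonNegative : ∀ m → ℚ.NonNegative (fromℕ m)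
fromℕ-nonNegative m = ℚ.nonNegative (fromℕ-mono-≤ {0} {m} z≤n)

inv-* : ∀ c q → .{{NonZero c}} → inv c ℚ.* fromℕ (c * q) ≡ fromℕ q
inv-* (suc c) q = trans (sym (fromℚᵘ-homo-* (mkℚᵘ (+ 1) c) (fromℕᵘ (suc c * q))))
  (ℚ.fromℚᵘ-cong {mkℚᵘ (+ 1) c ℚᵘ.* fromℕᵘ (suc c * q)} {fromℕᵘ q} (*≡* (begin
    + 1 ℤ.* + (suc c * q) ℤ.* + 1   ≡⟨ ℤ.*-identityʳ _ ⟩
    + 1 ℤ.* + (suc c * q)           ≡⟨ ℤ.*-identityˡ _ ⟩
    + (suc c * q)                   ≡⟨ cong +_ (ℕ.*-comm (suc c) q) ⟩
    + (q * suc c)                   ≡⟨ ℤ.pos-* q (suc c) ⟩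
    + q ℤ.* + suc c                 ≡⟨ cong (λ d → + q ℤ.* + suc d) (ℕ.*-identityʳ c) ⟨
    + q ℤ.* + (suc (c * 1))         ∎)))
  where open ≡-Reasoning

-- The weight of `F` times its binomial coefficient is `n !`, so multiplying by `n !` clears every
-- denominator in `h`.
h-* : ∀ (G : List (Subset n)) → h n G ℚ.* fromℕ (n !) ≡ fromℕ (∑ G weight)
h-* {n} []      = ℚ.*-zeroˡ (fromℕ (n !))
h-* {n} (F ∷ G) = begin
  (inv (n C ∣ F ∣ˢ) ℚ.+ h n G) ℚ.* fromℕ (n !)
    ≡⟨ ℚ.*-distribʳ-+ (fromℕ (n !)) (inv (n C ∣ F ∣ˢ)) (h n G) ⟩
  inv (n C ∣ F ∣ˢ) ℚ.* fromℕ (n !) ℚ.+ h n G ℚ.* fromℕ (n !)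
    ≡⟨ cong₂ ℚ._+_ (trans (cong (λ m → inv (n C ∣ F ∣ˢ) ℚ.* fromℕ m) (sym n!)) (inv-* (n C ∣ F ∣ˢ) (weight F) {{C≢0}})) (h-* G) ⟩
  fromℕ (weight F) ℚ.+ fromℕ (∑ G weight)
    ≡⟨ fromℕ-+ (weight F) (∑ G weight) ⟨
  fromℕ (weight F + ∑ G weight) ∎
  where
  open ≡-Reasoning
  n! : (n C ∣ F ∣ˢ) * weight F ≡ n !
  n! = C*k![n∸k]!≡n! (∣p∣≤n F)
  C≢0 : NonZero (n C ∣ F ∣ˢ)
  C≢0 = ℕ.m*n≢0⇒m≢0 (n C ∣ F ∣ˢ) {{subst NonZero (sym n!) (n ℕ.!≢0)}}

-- Clears the denominators `L` and `D`: `p` and `q` are `A` and `B` over `L`, and the error `K` over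
-- `D` is at most `ε`.
≤-scaled : ∀ {p q ε D A B K} L → .{{NonZero L}} → .{{NonZero D}} → p ℚ.* fromℕ L ≡ fromℕ A → q ℚ.* fromℕ L ≡ fromℕ B →
           fromℕ K ≤ fromℕ D ℚ.* ε → D * A ≤ℕ D * B + K * L → p ≤ q ℚ.+ ε
≤-scaled {p} {q} {ε} {D} {A} {B} {K} L pL qL K≤Dε DA≤ =
  ℚ.*-cancelˡ-≤-pos (fromℕ D) {{fromℕ-positive D}} (ℚ.*-cancelʳ-≤-pos (fromℕ L) {{fromℕ-positive L}} (begin
    fromℕ D ℚ.* p ℚ.* fromℕ L
      ≡⟨ trans (ℚ.*-assoc (fromℕ D) p _) (trans (cong (fromℕ D ℚ.*_) pL) (sym (fromℕ-* D A))) ⟩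
    fromℕ (D * A)
      ≤⟨ fromℕ-mono-≤ DA≤ ⟩
    fromℕ (D * B + K * L)
      ≡⟨ trans (fromℕ-+ (D * B) (K * L)) (cong₂ ℚ._+_ (trans (fromℕ-* D B) (cong (fromℕ D ℚ.*_) (sym qL))) (fromℕ-* K L)) ⟩
    fromℕ D ℚ.* (q ℚ.* fromℕ L) ℚ.+ fromℕ K ℚ.* fromℕ L
      ≤⟨ ℚ.+-monoʳ-≤ (fromℕ D ℚ.* (q ℚ.* fromℕ L)) (ℚ.*-monoʳ-≤-nonNeg (fromℕ L) {{fromℕ-nonNegative L}} K≤Dε) ⟩
    fromℕ D ℚ.* (q ℚ.* fromℕ L) ℚ.+ fromℕ D ℚ.* ε ℚ.* fromℕ L
      ≡⟨ solve 4 (λ d q l e → d :* (q :* l) :+ d :* e :* l := d :* (q :+ e) :* l) refl (fromℕ D) q (fromℕ L) ε ⟩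
    fromℕ D ℚ.* (q ℚ.+ ε) ℚ.* fromℕ L ∎))
  where
  open ℚ.≤-Reasoning
  open +-*-Solver

-- A positive fraction times its denominator is its numerator, which is at least 1.
archimedean : ∀ ε → 0ℚ < ε → ∀ K → fromℕ K ≤ fromℕ (K * ℚ.↧ₙ ε) ℚ.* ε
archimedean ε@(mkℚ +[1+ m ] d c) _ K = begin
  fromℕ K                              ≤⟨ fromℕ-mono-≤ (ℕ.m≤m*n K (suc m)) ⟩
  fromℕ (K * suc m)                    ≡⟨ ℚ.fromℚᵘ-cong {fromℕᵘ (K * suc m)} {fromℕᵘ (K * suc d) ℚᵘ.* toℚᵘ ε} (*≡* eq) ⟩
  fromℚᵘ (fromℕᵘ (K * suc d) ℚᵘ.* toℚᵘ ε) ≡⟨ fromℚᵘ-homo-* (fromℕᵘ (K * suc d)) (toℚᵘ ε) ⟩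
  fromℕ (K * suc d) ℚ.* fromℚᵘ (toℚᵘ ε) ≡⟨ cong (fromℕ (K * suc d) ℚ.*_) (ℚ.fromℚᵘ-toℚᵘ ε) ⟩
  fromℕ (K * suc d) ℚ.* ε              ∎
  where
  open ℚ.≤-Reasoning
  eqℕ : ∀ K m d → K * suc m * (suc d + 0) ≡ K * suc d * suc m * 1
  eqℕ = solve-∀
  eq : + (K * suc m) ℤ.* + (suc d + 0) ≡ + (K * suc d) ℤ.* + suc m ℤ.* + 1
  eq = trans (sym (ℤ.pos-* (K * suc m) (suc d + 0))) (trans (cong +_ (eqℕ K m d))
    (trans (ℤ.pos-* (K * suc d * suc m) 1) (cong (ℤ._* + 1) (ℤ.pos-* (K * suc d) (suc m)))))
archimedean (mkℚ (+ 0) d c)     (ℚ.*<* (ℤ.+<+ ()))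
archimedean (mkℚ -[1+ m ] d c)  (ℚ.*<* ())

-- Equality of the limits

∣-∣≤ : ∀ {p q ε} → q ≤ p → p ≤ q ℚ.+ ε → ∣ p - q ∣ ≤ ε
∣-∣≤ {p} {q} {ε} q≤p p≤q+ε = begin
  ∣ p - q ∣        ≡⟨ ℚ.0≤p⇒∣p∣≡p (subst (_≤ p - q) (ℚ.+-inverseʳ q) (ℚ.+-monoˡ-≤ (ℚ.- q) q≤p)) ⟩
  p - q             ≤⟨ ℚ.+-monoˡ-≤ (ℚ.- q) p≤q+ε ⟩
  q ℚ.+ ε - q       ≡⟨ xyx⁻¹≈y q ε ⟩
  ε                 ∎
  where open ℚ.≤-Reasoning

¬¬-∀-subset : ∀ {P : Subset n → Set} → (∀ X → ¬ ¬ P X) → ¬ ¬ (∀ X → P X)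
¬¬-∀-subset {zero}  h ¬all = h [] (λ p → ¬all λ { [] → p })
¬¬-∀-subset {suc n} h ¬all =
  ¬¬-∀-subset (λ X → h (outside ∷ X)) λ out → ¬¬-∀-subset (λ X → h (inside ∷ X)) λ ins →
  ¬all λ { (outside ∷ X) → out X ; (inside ∷ X) → ins X }

mainTheorem4 : (H : Hypergraph) (s : ℕ) → 2 ≤ℕ s →
    (a b : ℕ → ℚ) →
    (∀ n → IsPiN (blowup H s) n (a n)) →
    (∀ n → IsPiN H n (b n)) →
    (ε : ℚ) → 0ℚ < ε →
    Σ ℕ (λ N → (n : ℕ) → N ≤ℕ n → ∣ a n - b n ∣ ≤ ε)
mainTheorem4 H (suc s) _ a b πˢ π ε 0<ε = threshold (v H) (suc s) D , λ n n-large →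
  -- The goal is a decidable inequality, hence stable, so excluded middle for the edges of `H` may
  -- be used under a double negation.
  decidable-stable (∣ a n - b n ∣ ℚ.≤? ε)
    (¬¬-map (∣-∣≤ (b≤a n) ∘ a≤b+ε n n-large) (¬¬-∀-subset (λ F → ¬¬-excluded-middle)))
  where
  -- `K` is the total error in units of `n !`, and `D` is chosen so that `K` over `D` is at most
  -- `ε`.
  K D : ℕ
  K = 2 * suc (v H)
  D = K * ℚ.↧ₙ ε
  b≤a : ∀ n → b n ≤ a n
  b≤a n with (G , adm , hG≡b) , _ ← π n = subst (_≤ a n) hG≡b (proj₂ (πˢ n) G (blowup-admissible H s adm))
  a≤b+ε : ∀ n → threshold (v H) (suc s) D ≤ℕ n → (∀ F → Dec (E H F)) → a n ≤ b n ℚ.+ ε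
  a≤b+ε n n-large E? with (G , adm , hG≡a) , _ ← πˢ n with (G₀ , _ , hG₀≡b) , max ← π n =
    ≤-scaled {q = b n} {D = D} {B = ∑ G₀ weight} {K = K} (n !) {{n ℕ.!≢0}} {{ℕ.m*n≢0 K (ℚ.↧ₙ ε)}} (trans (cong (ℚ._* fromℕ (n !)) (sym hG≡a)) (h-* G))
      (trans (cong (ℚ._* fromℕ (n !)) (sym hG₀≡b)) (h-* G₀)) (archimedean ε 0<ε K)
      (subst (λ m → D * ∑ G weight ≤ℕ D * ∑ G₀ weight + m) (sym (ℕ.*-assoc 2 (suc (v H)) (n !)))
        (∑weight-blowup-free H (suc s) D n-large E? adm bound))
    where
    -- `G₀` maximises `h`, hence also the weight, which is `h` scaled by `n !`.
    bound : ∀ G' → Admissible H n G' → ∑ G' weight ≤ℕ ∑ G₀ weight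
    bound G' adm' = fromℕ-cancel-≤ (subst₂ _≤_ (h-* G') (h-* G₀)
      (ℚ.*-monoʳ-≤-nonNeg (fromℕ (n !)) {{fromℕ-nonNegative (n !)}} (subst (h n G' ≤_) (sym hG₀≡b) (max G' adm'))))
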